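{- Let $a,s,t$ be integers with $0\le a<s\le t$ and $s,t$ coprime. Then \[ \bigl|\mathcal{C}_{(s|0,a)}\cap\mathcal{C}_{(t|0,a)}\bigr|=\frac{(s+t-a-1)!}{a!\,(s-a)!\,(t-a)!}. \]
   Context: A partition is a weakly decreasing sequence of non-negative integers with finite sum; a bipartition is a pair $(\lambda,\mu)$ of partitions, with nodes $(a,b,1)$ for $b\le\lambda_a$ and $(a,b,2)$ for $b\le\mu_a$. For $s\ge0$ and $c=(c_1,c_2)\in\mathbb{Z}^2$, the $(s\,|\,c)$-residue of a node $(a,b,k)$ is $b-a+c_k+s\mathbb{Z}$, and the $(s\,|\,c)$-content of a bipartition is the multiset of residues of its nodes. A bipartition is an $(s\,|\,c)$-core if no other bipartition has the same $(s\,|\,c)$-content, except that for $s=1$ the only $(1\,|\,c)$-core is defined to be $(\varnothing,\varnothing)$; $\mathcal{C}_{(s|c_1,c_2)}$ is the set of such cores. -}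

module Defs where

open import Data.Nat as ℕ using (ℕ; zero; suc; _<_; _≥_)
open import Data.Nat.Divisibility using (_∣?_)
open import Data.Integer as ℤ using (ℤ; +_; ∣_∣)
open import Data.List using (List; []; _∷_)
open import Data.List.Relation.Unary.All using (All)
open import Data.List.Relation.Unary.Linked using (Linked)
open import Data.Product using (_×_; _,_)
open import Relation.Nullary using (does; ¬_)
open import Relation.Binary.PropositionalEquality using (_≡_)
open import Data.Bool using (if_then_else_)

IsPartition : List ℕ → Set
IsPartition xs = Linked _≥_ xs × All (0 <_) xs

Bipartition : Set
Bipartition = List ℕ × List ℕ

IsBipartition : Bipartition → Set
IsBipartition (l , m) = IsPartition l × IsPartition m

-- Indicator of  s ∣ z  (in ℤ; for s = 0 this means z = 0).
ind : ℕ → ℤ → ℕ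
ind s z = if does (s ∣? ∣ z ∣) then 1 else 0

rowCnt : ℕ → ℤ → ℕ → ℕ
rowCnt s z zero    = 0
rowCnt s z (suc b) = ind s (z ℤ.+ + suc b) ℕ.+ rowCnt s z b

-- partCnt s z a ls = #{ nodes (a', b) with a' = a+1, a+2, ... of rows ls : s ∣ z + b - a' }
partCnt : ℕ → ℤ → ℕ → List ℕ → ℕ
partCnt s z a []       = 0
partCnt s z a (l ∷ ls) = rowCnt s (z ℤ.- + suc a) l ℕ.+ partCnt s z (suc a) ls

-- Number of nodes of a bipartition whose (s|c)-residue is r + sℤ,
-- i.e. multiplicity of r + sℤ in the (s|c)-content.
countRes : ℕ → ℤ × ℤ → ℤ → Bipartition → ℕ
countRes s (c₁ , c₂) r (l , m) = partCnt s (c₁ ℤ.- r) 0 l ℕ.+ partCnt s (c₂ ℤ.- r) 0 m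

SameContent : ℕ → ℤ × ℤ → Bipartition → Bipartition → Set
SameContent s c B B' = ∀ (r : ℤ) → countRes s c r B ≡ countRes s c r B'

emptyBip : Bipartition
emptyBip = ([] , [])

IsCore : ℕ → ℤ × ℤ → Bipartition → Set
IsCore (suc zero) c B = B ≡ emptyBip
IsCore s          c B = ∀ (B' : Bipartition) → IsBipartition B' → SameContent s c B B' → B' ≡ B

{-# OPTIONS --safe #-}
-- Let X and Y be the beta-sets of the two components, with charges 0 and a.
--
-- The pair is an (s|0,a)-core exactly when X ⊆ Y and Y - s ⊆ X.  If x ∈ X ∖ Y, then, Y having the larger
-- charge, there is y ∈ Y ∖ X, and exchanging x and y between X and Y preserves the content; likewise
-- y ∈ Y with y - s ∉ X yields x ∈ X with x + s ∉ Y, and one moves y to y - s in X and x to x + s in Y.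
-- Conversely the content determines the sum of all beads and their number in each residue class mod s, and a
-- nested pair is the unique minimum of a linear combination of these quantities and the two charges.
--
-- Walk from v to v + t if v ∈ X, to v + t - s if v ∈ Y ∖ X, and to v - s if v ∉ Y, starting at the largest
-- element p of Y in some residue class mod s.  As s and t are coprime, the walk meets the largest element of Y
-- in each of the s classes once and closes up at p, with s - a, a and t - a steps of the three kinds.  Conversely
-- such a sequence of steps, not beginning with the last kind, recovers the pair up to translation, and the
-- translation is fixed by the charge.  So s times the number of simultaneous cores is the number of these
-- sequences, which is s (s + t - a - 1)! / (a! (s - a)! (t - a)!).

module Submission where

open import Defs
import Data.Integer.Properties as ℤₚ
open import Algebra.Properties.AbelianGroup ℤₚ.+-0-abelianGroup using (∙-cancelˡ; ∙-cancelʳ)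
open import Data.Bool using (if_then_else_)
open import Data.Empty using (⊥; ⊥-elim)
open import Data.Integer using (ℤ; +_; -[1+_]; 0ℤ; 1ℤ; -1ℤ; _+_; _-_; _*_; -_; ∣_∣; _≤_; _<_; +≤+; -≤+)
open import Data.Integer.Divisibility.Signed using (_∣_; divides; ∣⇒∣ᵤ; ∣ᵤ⇒∣; ∣-refl; ∣m∣n⇒∣m+n; ∣m∣n⇒∣m-n; ∣m+n∣n⇒∣m; ∣m⇒∣-m; ∣m⇒∣m*n)
open import Data.Integer.DivMod using (_%ℕ_; _/ℕ_; n%ℕd<d; a≡a%ℕn+[a/ℕn]*n)
open import Data.Integer.Tactic.RingSolver using (solve-∀)
open import Data.List using (List; []; _∷_; length; map; _++_; upTo; cartesianProduct; deduplicate)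
open import Data.List.Membership.DecPropositional ℤₚ._≟_ using (_∈?_)
open import Data.List.Membership.Propositional using (_∈_; _∉_; find; lose)
open import Data.List.Membership.Propositional.Properties using (∈-∃++; ∈-map⁺; ∈-map⁻; ∈-++⁺ˡ; ∈-++⁺ʳ; ∈-++⁻; ∈-upTo⁺; ∈-upTo⁻; ∈-cartesianProduct⁺; ∈-cartesianProduct⁻; ∈-deduplicate⁺; ∈-deduplicate⁻)
open import Data.List.Membership.Propositional.Properties.WithK using (unique∧set⇒bag)
import Data.List.Properties as Listₚ
open import Data.List.Relation.Binary.BagAndSetEquality using (∼bag⇒↭)
open import Data.List.Relation.Binary.Permutation.Propositional as Perm using (_↭_; ↭-sym)
open import Data.List.Relation.Binary.Permutation.Propositional.Properties using (↭-length; shift; ∈-resp-↭)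
open import Data.List.Relation.Unary.All as All using (All; []; _∷_)
import Data.List.Relation.Unary.All.Properties as Allₚ
open import Data.List.Relation.Unary.AllPairs using (AllPairs; []; _∷_)
open import Data.List.Relation.Unary.Any as Any using (Any; here; there; any?)
import Data.List.Relation.Unary.Any.Properties as Anyₚ
open import Data.List.Relation.Unary.Linked using (Linked; []; [-]; _∷_)
open import Data.List.Relation.Unary.Unique.DecPropositional.Properties using (deduplicate-!)
open import Data.List.Relation.Unary.Unique.Propositional using (Unique)
import Data.List.Relation.Unary.Unique.Propositional.Properties as Uniqueₚ
open import Data.Nat as ℕ using (ℕ; zero; suc; z≤n; s≤s; _∸_; _!)
open import Data.Nat.Coprimality using (Coprime; coprime-Bézout; coprime-divisor)
open import Data.Nat.Divisibility as ℕ∣ using (_∣?_)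
open import Data.Nat.GCD using (module Bézout)
import Data.Nat.Properties as ℕₚ
open import Data.Nat.Tactic.RingSolver using () renaming (solve-∀ to ℕ-solve-∀)
open import Data.Product using (Σ; ∃; _×_; _,_; proj₁; proj₂)
open import Data.Product.Properties using () renaming (≡-dec to ×-≡-dec)
open import Data.Sum as Sum using (_⊎_; inj₁; inj₂)
open import Data.Unit using (⊤; tt)
open import Function.Bundles using (_⇔_; mk⇔; module Equivalence)
open import Relation.Binary.PropositionalEquality
open import Relation.Nullary using (¬_; Dec; yes; no)
open import Relation.Nullary.Decidable using (_⊎-dec_; _×-dec_; ¬?; map′; decidable-stable; does-⇔; dec-true; dec-false)
open import Relation.Unary using (_⊆′_; _≐′_)

-- Contents are handled through `quot`, the floor of z / s. Counting a residue along a row gives the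
-- increment of `quot` between the ends of the row, so the multiplicity of r is, up to a constant
-- fixed by the charges, the sum of `quot s (x - r)` over the beads x of both components. This one
-- formula serves both directions: an exchange of beads changes the sum by increments that cancel,
-- and the linear span of 1 and the functions `quot s (x - r)` contains x and every function of the
-- residue of x, which is what the minimality argument needs. Beta-sets being infinite, such sums
-- run only over the beads above a base common to all the sets involved. The factor s is the choice
-- of the residue class in which the walk begins. Words are thereby counted as they stand, without
-- passing to classes under rotation: pairs of a core and a residue class correspond one to one to
-- words. Those beginning with D or E make up the fraction s / (s + t - a) of all words with the
-- given letters.

0≤+ : ∀ {n} → 0ℤ ≤ + n
0≤+ = +≤+ z≤n

-- An inequality is proved by writing the difference of its sides as a sum of gaps of known inequalities,
-- which leaves a ring identity.
infixl 6 _⊕_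
_⊕_ : ∀ {d e} → 0ℤ ≤ d → 0ℤ ≤ e → 0ℤ ≤ d + e
_⊕_ = ℤₚ.+-mono-≤

gap≤ : ∀ {i j} → i ≤ j → 0ℤ ≤ j - i
gap≤ = ℤₚ.i≤j⇒0≤j-i

gap< : ∀ {i j} → i < j → 0ℤ ≤ j - (1ℤ + i)
gap< i<j = ℤₚ.i≤j⇒0≤j-i (ℤₚ.i<j⇒suc[i]≤j i<j)

by≤ : ∀ {d i j} → 0ℤ ≤ d → j ≡ i + d → i ≤ j
by≤ {d} {i} 0≤d refl = subst (_≤ i + d) (ℤₚ.+-identityʳ i) (ℤₚ.+-monoʳ-≤ i 0≤d)

by< : ∀ {d i j} → 0ℤ ≤ d → j ≡ 1ℤ + i + d → i < j
by< 0≤d eq = ℤₚ.suc[i]≤j⇒i<j (by≤ 0≤d eq)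

absurd : ∀ {d} → 0ℤ ≤ d → d ≡ -1ℤ → ⊥
absurd () refl

≤⇒∃+ : ∀ {i j} → i ≤ j → ∃ λ n → j ≡ i + + n
≤⇒∃+ {i} {j} i≤j = ∣ j - i ∣ , trans (lemma i j) (cong (λ z → i + z) (sym (ℤₚ.0≤i⇒+∣i∣≡i (gap≤ i≤j))))
  where
  lemma : ∀ i j → j ≡ i + (j - i)
  lemma = solve-∀

+-cancelˡ : ∀ i {j k} → i + j ≡ i + k → j ≡ k
+-cancelˡ i {j} {k} = ∙-cancelˡ i j k

lower-bound : ∀ zs → ∃ λ b → All (b ≤_) zs
lower-bound []       = 0ℤ , []
lower-bound (z ∷ zs) with lower-bound zs
... | b , b≤zs with ℤₚ.≤-total b z
...   | inj₁ b≤z = b , b≤z ∷ b≤zs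
...   | inj₂ z≤b = z , ℤₚ.≤-refl ∷ All.map (ℤₚ.≤-trans z≤b) b≤zs

upper-bound : ∀ zs → ∃ λ b → All (_≤ b) zs
upper-bound []       = 0ℤ , []
upper-bound (z ∷ zs) with upper-bound zs
... | b , zs≤b with ℤₚ.≤-total z b
...   | inj₁ z≤b = b , z≤b ∷ zs≤b
...   | inj₂ b≤z = z , ℤₚ.≤-refl ∷ All.map (λ x≤b → ℤₚ.≤-trans x≤b b≤z) zs≤b

-- Beta-sets and charges

-- The beta-set { λᵢ - i + c : i ≥ 1 } of the partition λ (with infinitely many zero parts) at charge c.
Bead : ℤ → List ℕ → ℤ → Set
Bead c []       x = x < c
Bead c (l ∷ ls) x = x ≡ c - 1ℤ + + l ⊎ Bead (c - 1ℤ) ls x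

bead? : ∀ c ls x → Dec (Bead c ls x)
bead? c []       x = x ℤₚ.<? c
bead? c (l ∷ ls) x = (x ℤₚ.≟ c - 1ℤ + + l) ⊎-dec bead? (c - 1ℤ) ls x

pred< : ∀ {c x} → x < c - 1ℤ → x < c
pred< {c} {x} x<c-1 = by< (gap< x<c-1 ⊕ 0≤+ {1}) (lemma c x)
  where
  lemma : ∀ c x → c ≡ 1ℤ + x + (c - 1ℤ - (1ℤ + x) + 1ℤ)
  lemma = solve-∀

bead-low : ∀ c ls {x} → x < c - + length ls → Bead c ls x
bead-low c []       x<c = subst (_ <_) (ℤₚ.+-identityʳ c) x<c
bead-low c (l ∷ ls) {x} x<  = inj₂ (bead-low (c - 1ℤ) ls (subst (x <_) (lemma c (+ length ls)) x<))
  where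
  lemma : ∀ c n → c - (1ℤ + n) ≡ c - 1ℤ - n
  lemma = solve-∀

bead-bounded : ∀ c ls → ∃ λ hi → ∀ x → Bead c ls x → x < hi
bead-bounded c []       = c , λ x x<c → x<c
bead-bounded c (l ∷ ls) with bead-bounded (c - 1ℤ) ls
... | hi , below with upper-bound (hi ∷ (c + + l) ∷ [])
...   | b , hi≤b ∷ cl≤b ∷ [] = b , λ where
        x (inj₁ refl) → by< (gap≤ cl≤b) (lemma b c (+ l))
        x (inj₂ bd)   → ℤₚ.<-≤-trans (below x bd) hi≤b
  where
  lemma : ∀ b c l → b ≡ 1ℤ + (c - 1ℤ + l) + (b - (c + l))
  lemma = solve-∀

-- The parts weakly decrease while the charge drops by one with each row, so the beads strictly
-- decrease.
bead<top : ∀ c {l ls x} → Linked ℕ._≥_ (l ∷ ls) → Bead (c - 1ℤ) ls x → x < c - 1ℤ + + l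
bead<top c {l} {[]} {x} _ x<c = by< (gap< x<c ⊕ 0≤+ {l}) (lemma c (+ l) x)
  where
  lemma : ∀ c l x → c - 1ℤ + l ≡ 1ℤ + x + (c - 1ℤ - (1ℤ + x) + l)
  lemma = solve-∀
bead<top c {l} {k ∷ ls} (k≤l ∷ _) (inj₁ refl) = by< (gap≤ (+≤+ k≤l)) (lemma c (+ k) (+ l))
  where
  lemma : ∀ c k l → c - 1ℤ + l ≡ 1ℤ + (c - 1ℤ - 1ℤ + k) + (l - k)
  lemma = solve-∀
bead<top c {l} {k ∷ ls} {x} (k≤l ∷ lk) (inj₂ bd) =
  by< (gap< (bead<top (c - 1ℤ) lk bd) ⊕ gap≤ (+≤+ k≤l) ⊕ 0≤+ {1}) (lemma c (+ k) (+ l) x)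
  where
  lemma : ∀ c k l x → c - 1ℤ + l ≡ 1ℤ + x + ((c - 1ℤ - 1ℤ + k - (1ℤ + x)) + (l - k) + 1ℤ)
  lemma = solve-∀

linked-tail : ∀ {l ls} → Linked ℕ._≥_ (l ∷ ls) → Linked ℕ._≥_ ls
linked-tail [-]      = []
linked-tail (_ ∷ lk) = lk

partition-tail : ∀ {l ls} → IsPartition (l ∷ ls) → IsPartition ls
partition-tail (lk , _ ∷ pos) = linked-tail lk , pos

bead≤top : ∀ c {l ls x} → Linked ℕ._≥_ (l ∷ ls) → Bead c (l ∷ ls) x → x ≤ c - 1ℤ + + l
bead≤top c lk (inj₁ refl) = ℤₚ.≤-refl
bead≤top c lk (inj₂ bd)   = ℤₚ.<⇒≤ (bead<top c lk bd)

-- Positivity of the parts enters here: it puts the top bead at c or above, outside the beta-set of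
-- the empty partition.
bead-[]≢∷ : ∀ c {l ls} → IsPartition (l ∷ ls) → ¬ (Bead c (l ∷ ls) ⊆′ Bead c [])
bead-[]≢∷ c {suc l} ip sub = absurd (gap< (sub _ (inj₁ refl)) ⊕ 0≤+ {l}) (lemma c (+ l))
  where
  lemma : ∀ c l → c - (1ℤ + (c - 1ℤ + (1ℤ + l))) + l ≡ -1ℤ
  lemma = solve-∀
bead-[]≢∷ c {zero} (_ , () ∷ _) sub

-- The top bead is the maximum of its beta-set, so equal beta-sets have equal first parts; without
-- that bead there remain the beta-sets of the tails at charge c - 1.
bead-injective : ∀ c {ls ms} → IsPartition ls → IsPartition ms → Bead c ls ≐′ Bead c ms → ls ≡ ms
bead-injective c {[]}     {[]}     _  _  _       = refl
bead-injective c {[]}     {_ ∷ _}  _  im (_ , g) = ⊥-elim (bead-[]≢∷ c im g)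
bead-injective c {_ ∷ _}  {[]}     il _  (f , _) = ⊥-elim (bead-[]≢∷ c il f)
bead-injective c {l ∷ ls} {m ∷ ms} il im (f , g)
  with refl ← ℤₚ.+-injective (+-cancelˡ (c - 1ℤ) (ℤₚ.≤-antisym
                (bead≤top c (proj₁ im) (f _ (inj₁ refl))) (bead≤top c (proj₁ il) (g _ (inj₁ refl)))))
  = cong (l ∷_) (bead-injective (c - 1ℤ) (partition-tail il) (partition-tail im)
                  (tail il f , tail im g))
  where
  tail : ∀ {l ls ms} → IsPartition (l ∷ ls) → Bead c (l ∷ ls) ⊆′ Bead c (l ∷ ms) →
         Bead (c - 1ℤ) ls ⊆′ Bead (c - 1ℤ) ms
  tail il f x bd with f x (inj₂ bd)
  ... | inj₂ bd′ = bd′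
  ... | inj₁ eq  = ⊥-elim (ℤₚ.<-irrefl eq (bead<top c (proj₁ il) bd))

bead-shift : ∀ k c ls {x} → Bead c ls x → Bead (c + k) ls (x + k)
bead-shift k c []       x<c = ℤₚ.+-monoˡ-< k x<c
bead-shift k c (l ∷ ls) (inj₁ refl) = inj₁ (lemma c k (+ l))
  where
  lemma : ∀ c k l → c - 1ℤ + l + k ≡ c + k - 1ℤ + l
  lemma = solve-∀
bead-shift k c (l ∷ ls) {x} (inj₂ bd) = inj₂ (subst (λ c → Bead c ls (x + k)) (lemma c k) (bead-shift k (c - 1ℤ) ls bd))
  where
  lemma : ∀ c k → c - 1ℤ + k ≡ c + k - 1ℤ
  lemma = solve-∀

-- If c = b + n and n is at least the number of parts, these are exactly the beads that are not
-- below b. Past the last part the implicit zero parts are used.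
beads : ℤ → List ℕ → ℕ → List ℤ
beads c ls       zero    = []
beads c []       (suc n) = c - 1ℤ ∷ beads (c - 1ℤ) [] n
beads c (l ∷ ls) (suc n) = c - 1ℤ + + l ∷ beads (c - 1ℤ) ls n

length-beads : ∀ c ls n → length (beads c ls n) ≡ n
length-beads c ls       zero    = refl
length-beads c []       (suc n) = cong suc (length-beads (c - 1ℤ) [] n)
length-beads c (l ∷ ls) (suc n) = cong suc (length-beads (c - 1ℤ) ls n)

∈-beads⇒Bead : ∀ c ls n {x} → x ∈ beads c ls n → Bead c ls x
∈-beads⇒Bead c []       (suc n) (here refl) = by< (0≤+ {0}) (lemma c)
  where
  lemma : ∀ c → c ≡ 1ℤ + (c - 1ℤ) + 0ℤ
  lemma = solve-∀
∈-beads⇒Bead c []       (suc n) (there x∈) = pred< (∈-beads⇒Bead (c - 1ℤ) [] n x∈)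
∈-beads⇒Bead c (l ∷ ls) (suc n) (here eq)  = inj₁ eq
∈-beads⇒Bead c (l ∷ ls) (suc n) (there x∈) = inj₂ (∈-beads⇒Bead (c - 1ℤ) ls n x∈)

∈-beads⇒≥ : ∀ b n ls {x} → x ∈ beads (b + + n) ls n → b ≤ x
∈-beads⇒≥ b (suc n) ls x∈ = go ls x∈
  where
  eq : b + + suc n - 1ℤ ≡ b + + n
  eq = lemma b (+ n)
    where
    lemma : ∀ b n → b + (1ℤ + n) - 1ℤ ≡ b + n
    lemma = solve-∀
  lemma₁ : ∀ b n l → b + (1ℤ + n) - 1ℤ + l ≡ b + (n + l)
  lemma₁ = solve-∀
  go : ∀ ls {x} → x ∈ beads (b + + suc n) ls (suc n) → b ≤ x
  go []       (here refl) = by≤ (0≤+ {n}) eq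
  go []       (there x∈)  = ∈-beads⇒≥ b n [] (subst (λ c → _ ∈ beads c [] n) eq x∈)
  go (l ∷ ls) (here refl) = by≤ (0≤+ {n} ⊕ 0≤+ {l}) (lemma₁ b (+ n) (+ l))
  go (l ∷ ls) (there x∈)  = ∈-beads⇒≥ b n ls (subst (λ c → _ ∈ beads c ls n) eq x∈)

Bead⇒∈-beads : ∀ b n ls {x} → length ls ℕ.≤ n → b ≤ x → Bead (b + + n) ls x → x ∈ beads (b + + n) ls n
Bead⇒∈-beads b zero [] {x} _ b≤x x<b = ⊥-elim (absurd (gap≤ b≤x ⊕ gap< x<b) (lemma b x))
  where
  lemma : ∀ b x → x - b + (b + 0ℤ - (1ℤ + x)) ≡ -1ℤ
  lemma = solve-∀
Bead⇒∈-beads b (suc n) ls {x} len b≤x bd = go ls len bd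
  where
  eq : b + + suc n - 1ℤ ≡ b + + n
  eq = lemma b (+ n)
    where
    lemma : ∀ b n → b + (1ℤ + n) - 1ℤ ≡ b + n
    lemma = solve-∀
  below : x < b + + suc n → x ≢ b + + suc n - 1ℤ → x < b + + n
  below x< x≢ = ℤₚ.≤∧≢⇒< (by≤ (gap< x<) (lemma b (+ n) x)) (λ e → x≢ (trans e (sym eq)))
    where
    lemma : ∀ b n x → b + n ≡ x + (b + (1ℤ + n) - (1ℤ + x))
    lemma = solve-∀
  go : ∀ ls → length ls ℕ.≤ suc n → Bead (b + + suc n) ls x → x ∈ beads (b + + suc n) ls (suc n)
  go [] _ x< with x ℤₚ.≟ b + + suc n - 1ℤ
  ... | yes x≡ = here x≡
  ... | no x≢  = there (subst (λ c → x ∈ beads c [] n) (sym eq) (Bead⇒∈-beads b n [] z≤n b≤x (below x< x≢)))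
  go (l ∷ ls) _         (inj₁ x≡) = here x≡
  go (l ∷ ls) (s≤s len) (inj₂ bd) = there (subst (λ c → x ∈ beads c ls n) (sym eq)
    (Bead⇒∈-beads b n ls len b≤x (subst (λ c → Bead c ls x) eq bd)))

beads-unique : ∀ c {ls} n → Linked ℕ._≥_ ls → Unique (beads c ls n)
beads-unique c zero _ = []
beads-unique c {[]} (suc n) _ =
  All.tabulate (λ x∈ eq → ℤₚ.<-irrefl (sym eq) (∈-beads⇒Bead (c - 1ℤ) [] n x∈)) ∷ beads-unique (c - 1ℤ) n []
beads-unique c {l ∷ ls} (suc n) lk =
  All.tabulate (λ x∈ eq → ℤₚ.<-irrefl (sym eq) (bead<top c lk (∈-beads⇒Bead (c - 1ℤ) ls n x∈)))
  ∷ beads-unique (c - 1ℤ) n (linked-tail lk)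

HasCharge : ℤ → (ℤ → Set) → Set
HasCharge c P = ∃ λ ls → IsPartition ls × P ≐′ Bead c ls

≐-refl : ∀ {P : ℤ → Set} → P ≐′ P
≐-refl = (λ _ p → p) , (λ _ p → p)

bead-charge : ∀ {c ls} → IsPartition ls → HasCharge c (Bead c ls)
bead-charge {ls = ls} ip = ls , ip , ≐-refl

-- The parts are read off by peeling off the largest element.
charge : (P : ℤ → Set) → (∀ x → Dec (P x)) → ∀ lo n →
         (∀ x → x < lo → P x) → (∀ x → lo + + n ≤ x → ¬ P x) →
         ∃ λ c → c ≤ lo + + n × HasCharge c P
charge P P? lo zero low high = lo , ℤₚ.≤-reflexive (sym (ℤₚ.+-identityʳ lo)) , [] , ([] , []) ,
  (λ x p → ℤₚ.≰⇒> λ lo≤x → high x (subst (_≤ x) (sym (ℤₚ.+-identityʳ lo)) lo≤x) p) , low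
charge P P? lo (suc n) low high with P? (lo + + n)
... | no ¬top = c , ℤₚ.≤-trans c≤ (by≤ (0≤+ {1}) (lemma lo (+ n))) , hc
  where
  lemma : ∀ b n → b + (1ℤ + n) ≡ b + n + 1ℤ
  lemma = solve-∀
  high′ : ∀ x → lo + + n ≤ x → ¬ P x
  high′ x le p with x ℤₚ.≟ lo + + n
  ... | yes refl = ¬top p
  ... | no x≢ = high x (by≤ (gap< (ℤₚ.≤∧≢⇒< le (≢-sym x≢))) (lemma₁ lo (+ n) x)) p
    where
    lemma₁ : ∀ lo n x → x ≡ lo + (1ℤ + n) + (x - (1ℤ + (lo + n)))
    lemma₁ = solve-∀
  rec = charge P P? lo n low high′
  c = proj₁ rec
  c≤ = proj₁ (proj₂ rec)
  hc = proj₂ (proj₂ rec)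
... | yes top = add (charge P′ (λ x → P? x ×-dec (x ℤₚ.<? lo + + n)) lo n
                      (λ x x< → low x x< , ℤₚ.<-≤-trans x< (by≤ (0≤+ {n}) refl))
                      (λ x le p → ℤₚ.<⇒≱ (proj₂ p) le))
  where
  P′ : ℤ → Set
  P′ x = P x × x < lo + + n
  below : ∀ x → P x → x ≢ lo + + n → x < lo + + n
  below x p x≢ = ℤₚ.≤∧≢⇒< (ℤₚ.≮⇒≥ λ gt → high x (by≤ (gap< gt) (lemma lo (+ n) x)) p) x≢
    where
    lemma : ∀ lo n x → x ≡ lo + (1ℤ + n) + (x - (1ℤ + (lo + n)))
    lemma = solve-∀
  add : (∃ λ c → c ≤ lo + + n × HasCharge c P′) → ∃ λ c → c ≤ lo + + suc n × HasCharge c P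
  add (c , c≤ , ls , ip , f , g) with ≤⇒∃+ c≤
  ... | l , top≡ = c + 1ℤ , by≤ (gap≤ c≤) (lemma c lo (+ n)) , extend l ls top≡ ip f g
    where
    lemma : ∀ c lo n → lo + (1ℤ + n) ≡ c + 1ℤ + (lo + n - c)
    lemma = solve-∀
    lemma₁ : ∀ c → c + 1ℤ - 1ℤ ≡ c
    lemma₁ = solve-∀
    cons : ∀ l ls → lo + + n ≡ c + + l → P′ ≐′ Bead c ls → P ≐′ Bead (c + 1ℤ) (l ∷ ls)
    cons l ls top≡ (f , g) = to , from
      where
      to : P ⊆′ Bead (c + 1ℤ) (l ∷ ls)
      to x p with x ℤₚ.≟ lo + + n
      ... | yes x≡ = inj₁ (trans x≡ (trans top≡ (cong (λ z → z + + l) (sym (lemma₁ c)))))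
      ... | no x≢  = inj₂ (subst (λ c → Bead c ls x) (sym (lemma₁ c)) (f x (p , below x p x≢)))
      from : Bead (c + 1ℤ) (l ∷ ls) ⊆′ P
      from x (inj₁ refl) = subst P (trans top≡ (cong (λ z → z + + l) (sym (lemma₁ c)))) top
      from x (inj₂ bd)   = proj₁ (g x (subst (λ c → Bead c ls x) (lemma₁ c) bd))
    head≤ : ∀ {l k ks} → lo + + n ≡ c + + l → Bead c (k ∷ ks) ⊆′ P′ → k ℕ.≤ l
    head≤ {l} {k} top≡ g = ℤₚ.drop‿+≤+ (by≤ (gap< (subst (c - 1ℤ + + k <_) top≡ (proj₂ (g _ (inj₁ refl))))) (lemma₂ c (+ k) (+ l)))
      where
      lemma₂ : ∀ c k l → l ≡ k + (c + l - (1ℤ + (c - 1ℤ + k)))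
      lemma₂ = solve-∀
    extend : ∀ l ls → lo + + n ≡ c + + l → IsPartition ls → P′ ⊆′ Bead c ls → Bead c ls ⊆′ P′ →
             HasCharge (c + 1ℤ) P
    extend (suc l) [] top≡ _ f g = suc l ∷ [] , ([-] , s≤s z≤n ∷ []) , cons (suc l) [] top≡ (f , g)
    extend (suc l) (k ∷ ks) top≡ (lk , pos) f g =
      suc l ∷ k ∷ ks , (head≤ top≡ g ∷ lk , s≤s z≤n ∷ pos) , cons (suc l) (k ∷ ks) top≡ (f , g)
    extend zero (zero ∷ ks) top≡ (_ , () ∷ _) f g
    extend zero (suc k ∷ ks) top≡ ip f g with () ← head≤ top≡ g
    -- The removed element is c itself, so its part would be 0. No part is added; the interval below
    -- c just grows to the interval below c + 1.
    extend zero [] top≡ _ f g = [] , ([] , []) ,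
      (λ x p → unzero x (proj₁ (cons zero [] top≡ (f , g)) x p)) ,
      (λ x x< → proj₂ (cons zero [] top≡ (f , g)) x (rezero x x<))
      where
      unzero : ∀ x → Bead (c + 1ℤ) (0 ∷ []) x → x < c + 1ℤ
      unzero x (inj₁ refl) = by< (0≤+ {0}) (lemma₃ c)
        where
        lemma₃ : ∀ c → c + 1ℤ ≡ 1ℤ + (c + 1ℤ - 1ℤ + 0ℤ) + 0ℤ
        lemma₃ = solve-∀
      unzero x (inj₂ x<) = pred< x<
      rezero : ∀ x → x < c + 1ℤ → Bead (c + 1ℤ) (0 ∷ []) x
      rezero x x< with x ℤₚ.≟ c + 1ℤ - 1ℤ + 0ℤ
      ... | yes x≡ = inj₁ x≡
      ... | no x≢ = inj₂ (ℤₚ.≤∧≢⇒< (by≤ (gap< x<) (lemma₃ c x)) (λ e → x≢ (trans e (sym (ℤₚ.+-identityʳ _)))))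
        where
        lemma₃ : ∀ c x → c + 1ℤ - 1ℤ ≡ x + (c + 1ℤ - (1ℤ + x))
        lemma₃ = solve-∀

-- Finite lists as sets, and sums over them

unique-↭ : ∀ {A : Set} {xs ys : List A} → Unique xs → Unique ys →
           (∀ x → x ∈ xs → x ∈ ys) → (∀ x → x ∈ ys → x ∈ xs) → xs ↭ ys
unique-↭ ux uy f g = ∼bag⇒↭ (unique∧set⇒bag ux uy (mk⇔ (f _) (g _)))

∈⇒↭∷ : ∀ {A : Set} {x : A} {xs} → x ∈ xs → ∃ λ ys → xs ↭ x ∷ ys
∈⇒↭∷ x∈ with ∈-∃++ x∈
... | ys , zs , refl = ys ++ zs , shift _ ys zs

∉⇒Unique∷ : ∀ {A : Set} {x : A} {xs} → x ∉ xs → Unique xs → Unique (x ∷ xs)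
∉⇒Unique∷ x∉ u = All.tabulate (λ { y∈ refl → x∉ y∈ }) ∷ u

∷-≢⇒∈ : ∀ {A : Set} {x y : A} {xs} → y ∈ x ∷ xs → x ≢ y → y ∈ xs
∷-≢⇒∈ (here refl) x≢y = ⊥-elim (x≢y refl)
∷-≢⇒∈ (there y∈)  _   = y∈

unique-⊆⇒length≤ : ∀ {A : Set} {xs ys : List A} → Unique xs → (∀ x → x ∈ xs → x ∈ ys) → length xs ℕ.≤ length ys
unique-⊆⇒length≤ {xs = []}     _          _   = z≤n
unique-⊆⇒length≤ {xs = x ∷ xs} (x∉ ∷ uxs) sub with ∈⇒↭∷ (sub x (here refl))
... | zs , ys↭ = subst (suc (length xs) ℕ.≤_) (sym (↭-length ys↭))
  (s≤s (unique-⊆⇒length≤ uxs λ y y∈ → ∷-≢⇒∈ (∈-resp-↭ ys↭ (sub y (there y∈))) (All.lookup x∉ y∈)))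

∑ : List ℤ → (ℤ → ℤ) → ℤ
∑ []       f = 0ℤ
∑ (x ∷ xs) f = f x + ∑ xs f

∑-↭ : ∀ {xs ys} f → xs ↭ ys → ∑ xs f ≡ ∑ ys f
∑-↭ f Perm.refl          = refl
∑-↭ f (Perm.prep x p)    = cong (λ z → f x + z) (∑-↭ f p)
∑-↭ f (Perm.swap {xs} {ys} x y p) = trans (cong (λ z → f x + (f y + z)) (∑-↭ f p)) (lemma (f x) (f y) (∑ ys f))
  where
  lemma : ∀ a b c → a + (b + c) ≡ b + (a + c)
  lemma = solve-∀
∑-↭ f (Perm.trans p q)   = trans (∑-↭ f p) (∑-↭ f q)

∑-cong : ∀ xs {f g} → (∀ x → f x ≡ g x) → ∑ xs f ≡ ∑ xs g
∑-cong []       eq = refl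
∑-cong (x ∷ xs) eq = cong₂ _+_ (eq x) (∑-cong xs eq)

∑-+ : ∀ xs f g → ∑ xs (λ x → f x + g x) ≡ ∑ xs f + ∑ xs g
∑-+ []       f g = refl
∑-+ (x ∷ xs) f g = trans (cong (λ z → f x + g x + z) (∑-+ xs f g)) (lemma (f x) (g x) (∑ xs f) (∑ xs g))
  where
  lemma : ∀ a b c d → a + b + (c + d) ≡ a + c + (b + d)
  lemma = solve-∀

∑-* : ∀ xs k f → ∑ xs (λ x → k * f x) ≡ k * ∑ xs f
∑-* []       k f = sym (ℤₚ.*-zeroʳ k)
∑-* (x ∷ xs) k f = trans (cong (λ z → k * f x + z) (∑-* xs k f)) (sym (ℤₚ.*-distribˡ-+ k (f x) _))

∑-const : ∀ xs k → ∑ xs (λ _ → k) ≡ + length xs * k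
∑-const []       k = refl
∑-const (x ∷ xs) k = trans (cong (λ z → k + z) (∑-const xs k)) (lemma k (+ length xs))
  where
  lemma : ∀ k n → k + n * k ≡ (1ℤ + n) * k
  lemma = solve-∀

-- When P contains everything below b, the size condition says that P has charge c.
record Window (P : ℤ → Set) (c b : ℤ) (xs : List ℤ) : Set where
  constructor window
  field
    unique   : Unique xs
    sound    : ∀ x → x ∈ xs → P x × b ≤ x
    complete : ∀ x → P x → b ≤ x → x ∈ xs
    size     : c ≡ b + + length xs

beads-window : ∀ {P} b n {ls} → IsPartition ls → length ls ℕ.≤ n → P ≐′ Bead (b + + n) ls →
               Window P (b + + n) b (beads (b + + n) ls n)
beads-window b n {ls} (lk , _) len (f , g) = window
  (beads-unique (b + + n) n lk)
  (λ x x∈ → g x (∈-beads⇒Bead _ ls n x∈) , ∈-beads⇒≥ b n ls x∈)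
  (λ x p b≤x → Bead⇒∈-beads b n ls len b≤x (f x p))
  (cong (λ k → b + + k) (sym (length-beads _ ls n)))

split-charge : ∀ {b} c k → b ≤ c - + k → ∃ λ n → c ≡ b + + n × k ℕ.≤ n
split-charge {b} c k b≤ with ≤⇒∃+ b≤
... | d , eq = k ℕ.+ d , trans (lemma c (+ k)) (trans (cong (λ z → z + + k) eq) (lemma′ b (+ k) (+ d))) , ℕₚ.m≤m+n k d
  where
  lemma : ∀ c k → c ≡ c - k + k
  lemma = solve-∀
  lemma′ : ∀ b k d → b + d + k ≡ b + (k + d)
  lemma′ = solve-∀

charge-window : ∀ {P c b} → ((ls , _) : HasCharge c P) → b ≤ c - + length ls → ∃ (Window P c b)
charge-window {c = c} (ls , ip , eq) b≤ with split-charge c (length ls) b≤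
... | n , refl , len = _ , beads-window _ n ip len eq

windows : ∀ {P Q c c′} → HasCharge c P → HasCharge c′ Q → ∀ zs →
          ∃ λ b → All (b ≤_) zs × ∃ (Window P c b) × ∃ (Window Q c′ b)
windows {c = c} {c′} hp@(ls , _) hq@(ms , _) zs with lower-bound ((c - + length ls) ∷ (c′ - + length ms) ∷ zs)
... | b , b≤c ∷ b≤c′ ∷ b≤zs = b , b≤zs , charge-window hp b≤c , charge-window hq b≤c′

charge-dec : ∀ {P c} → HasCharge c P → ∀ x → Dec (P x)
charge-dec {c = c} (ls , _ , f , g) x = map′ (g x) (f x) (bead? c ls x)

-- Above a common base the window of Q is that of P together with `ds`, and a charge is the base
-- plus the size of the window.
charge-diff : ∀ {P Q c c′ ds} → HasCharge c P → HasCharge c′ Q → Unique ds →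
              (∀ x → P x → Q x) → (∀ x → x ∈ ds → Q x × ¬ P x) → (∀ x → Q x → ¬ P x → x ∈ ds) →
              c′ ≡ c + + length ds
charge-diff {ds = ds} hp hq ud P⊆Q ds⊆ ⊆ds with windows hp hq ds
... | b , b≤ds , (xs , wx) , (ys , wy) = begin
  _                                       ≡⟨ Window.size wy ⟩
  b + + length ys                         ≡⟨ cong (λ n → b + + n) (↭-length (unique-↭ (Window.unique wy)
      (Uniqueₚ.++⁺ (Window.unique wx) ud λ (x∈ , d∈) → proj₂ (ds⊆ _ d∈) (proj₁ (Window.sound wx _ x∈))) to from)) ⟩
  b + + length (xs ++ ds)                 ≡⟨ cong (λ n → b + + n) (Listₚ.length-++ xs) ⟩
  b + (+ length xs + + length ds)         ≡⟨ sym (ℤₚ.+-assoc b _ _) ⟩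
  b + + length xs + + length ds           ≡⟨ cong (λ z → z + + length ds) (sym (Window.size wx)) ⟩
  _                                       ∎
  where
  open ≡-Reasoning
  to : ∀ x → x ∈ ys → x ∈ xs ++ ds
  to x x∈ with Window.sound wy x x∈ | charge-dec hp x
  ... | q , b≤ | yes p = ∈-++⁺ˡ (Window.complete wx x p b≤)
  ... | q , b≤ | no ¬p = ∈-++⁺ʳ xs (⊆ds x q ¬p)
  from : ∀ x → x ∈ xs ++ ds → x ∈ ys
  from x x∈ with ∈-++⁻ xs x∈
  ... | inj₁ x∈xs = Window.complete wy x (P⊆Q x (proj₁ (Window.sound wx x x∈xs))) (proj₂ (Window.sound wx x x∈xs))
  ... | inj₂ x∈ds = Window.complete wy x (proj₁ (ds⊆ x x∈ds)) (All.lookup b≤ds x∈ds)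

charge-unique : ∀ {P c c′} → HasCharge c P → HasCharge c′ P → c′ ≡ c
charge-unique hp hp′ = trans (charge-diff hp hp′ [] (λ _ p → p) (λ _ ()) (λ _ p ¬p → ⊥-elim (¬p p))) (ℤₚ.+-identityʳ _)

-- If every element of Q were in P, the window of P would contain that of Q and also x, so P would
-- have the larger charge.
charge-pigeonhole : ∀ {P Q c c′ x} → HasCharge c P → HasCharge c′ Q → c ≤ c′ → P x → ¬ Q x → ∃ λ y → Q y × ¬ P y
charge-pigeonhole {P} {Q} {c} {c′} {x} hp hq c≤c′ p ¬q with windows hp hq (x ∷ [])
... | b , b≤x ∷ [] , (xs , wx) , (ys , wy) with any? (λ y → ¬? (charge-dec hp y)) ys
...   | yes found = let y , y∈ , ¬py = find found in y , proj₁ (Window.sound wy y y∈) , ¬py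
...   | no none   = ⊥-elim (ℕₚ.<⇒≱ longer (ℤₚ.drop‿+≤+ shorter))
  where
  all-P : ∀ y → y ∈ ys → P y
  all-P y y∈ = decidable-stable (charge-dec hp y) (λ ¬py → none (lose y∈ ¬py))
  longer : suc (length ys) ℕ.≤ length xs
  longer = unique-⊆⇒length≤ (∉⇒Unique∷ (λ x∈ → ¬q (proj₁ (Window.sound wy x x∈))) (Window.unique wy)) λ where
    _ (here refl) → Window.complete wx x p b≤x
    y (there y∈)  → Window.complete wx y (all-P y y∈) (proj₂ (Window.sound wy y y∈))
  lemma : ∀ b m n → n ≡ m + (b + n - (b + m))
  lemma = solve-∀
  shorter : + length xs ≤ + length ys
  shorter = by≤ (gap≤ (subst₂ _≤_ (Window.size wx) (Window.size wy) c≤c′)) (lemma b (+ length xs) (+ length ys))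

charge-shift : ∀ k {P c} → HasCharge c P → HasCharge (c + k) (λ x → P (x - k))
charge-shift k {P} {c} (ls , ip , f , g) = ls , ip ,
  (λ x p → subst (Bead (c + k) ls) (lemma x k) (bead-shift k c ls (f _ p))) ,
  (λ x bd → g _ (subst (λ c → Bead c ls (x - k)) (lemma′ c k) (bead-shift (- k) (c + k) ls bd)))
  where
  lemma : ∀ x k → x - k + k ≡ x
  lemma = solve-∀
  lemma′ : ∀ c k → c + k - k ≡ c
  lemma′ = solve-∀

charge-cong : ∀ {P Q c} → Q ≐′ P → HasCharge c P → HasCharge c Q
charge-cong (f , g) (ls , ip , f′ , g′) = ls , ip , (λ x q → f′ x (f x q)) , (λ x bd → g x (g′ x bd))

Replace : (P : ℤ → Set) (x x′ : ℤ) → ℤ → Set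
Replace P x x′ z = z ≡ x′ ⊎ (P z × z ≢ x)

-- Each list is extended by the element that it lacks, so that sums can be compared without deleting
-- anything from a list.
replace-↭ : ∀ {P c c′ b x x′ xs ys} → P x → ¬ P x′ → b ≤ x → b ≤ x′ →
            Window P c b xs → Window (Replace P x x′) c′ b ys → x ∷ ys ↭ x′ ∷ xs
replace-↭ {P} {b = b} {x} {x′} {xs} {ys} p ¬p′ b≤x b≤x′ wx wy =
  unique-↭ (∉⇒Unique∷ x∉ys (Window.unique wy))
           (∉⇒Unique∷ (λ x′∈ → ¬p′ (proj₁ (Window.sound wx x′ x′∈))) (Window.unique wx)) to from
  where
  x∉ys : x ∉ ys
  x∉ys x∈ with proj₁ (Window.sound wy x x∈)
  ... | inj₁ refl      = ¬p′ p
  ... | inj₂ (_ , x≢x) = x≢x refl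
  to : ∀ z → z ∈ x ∷ ys → z ∈ x′ ∷ xs
  to z (here refl) = there (Window.complete wx x p b≤x)
  to z (there z∈) with Window.sound wy z z∈
  ... | inj₁ refl    , _   = here refl
  ... | inj₂ (q , _) , b≤z = there (Window.complete wx z q b≤z)
  from : ∀ z → z ∈ x′ ∷ xs → z ∈ x ∷ ys
  from z (here refl) = there (Window.complete wy x′ (inj₁ refl) b≤x′)
  from z (there z∈) with z ℤₚ.≟ x
  ... | yes z≡x = here z≡x
  ... | no z≢x  = let q , b≤z = Window.sound wx z z∈ in there (Window.complete wy z (inj₂ (q , z≢x)) b≤z)

charge-exists : (P : ℤ → Set) → (∀ x → Dec (P x)) → ∀ lo hi → (∀ x → x < lo → P x) → (∀ x → hi ≤ x → ¬ P x) →
                ∃ λ c → HasCharge c P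
charge-exists P P? lo hi low high with ℤₚ.≤-total lo hi
... | inj₁ lo≤hi with ≤⇒∃+ lo≤hi
...   | n , refl = let c , _ , hc = charge P P? lo n low high in c , hc
charge-exists P P? lo hi low high | inj₂ hi≤lo =
  let c , _ , hc = charge P P? lo 0 low (λ x le → high x (ℤₚ.≤-trans hi≤lo (subst (_≤ x) (ℤₚ.+-identityʳ lo) le))) in c , hc

-- The new set is again full far below and empty far above, hence has some charge. Its window is as
-- long as the old one, one element having been exchanged, so that charge is c.
charge-replace : ∀ {P c x x′} → HasCharge c P → P x → ¬ P x′ → HasCharge c (Replace P x x′)
charge-replace {P} {c} {x} {x′} hp@(ls , _ , f , g) p ¬p′
  with lower-bound ((c - + length ls) ∷ x ∷ []) | bead-bounded c ls
... | lo , lo≤c ∷ lo≤x ∷ [] | hi , below with upper-bound (hi ∷ (1ℤ + x′) ∷ [])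
... | hi′ , hi≤ ∷ x′< ∷ [] = subst (λ c → HasCharge c _) same (proj₂ new)
  where
  new : ∃ λ c′ → HasCharge c′ (Replace P x x′)
  new = charge-exists (Replace P x x′)
    (λ z → (z ℤₚ.≟ x′) ⊎-dec (charge-dec hp z ×-dec ¬? (z ℤₚ.≟ x))) lo hi′
    (λ z z< → inj₂ (g z (bead-low c ls (ℤₚ.<-≤-trans z< lo≤c)) , λ { refl → ℤₚ.<⇒≱ z< lo≤x }))
    (λ { z le (inj₁ refl) → ℤₚ.<⇒≱ (ℤₚ.suc[i]≤j⇒i<j x′<) le
       ; z le (inj₂ (q , _)) → ℤₚ.<⇒≱ (below z (f z q)) (ℤₚ.≤-trans hi≤ le) })
  same : proj₁ new ≡ c
  same with windows hp (proj₂ new) (x ∷ x′ ∷ [])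
  ... | b , b≤x ∷ b≤x′ ∷ [] , (xs , wx) , (ys , wy) =
    trans (Window.size wy) (trans (cong (λ n → b + + n)
      (ℕₚ.suc-injective (↭-length (replace-↭ p ¬p′ b≤x b≤x′ wx wy)))) (sym (Window.size wx)))

-- Contents in terms of beads

ind-⇔ : ∀ s {y z} → (+ s ∣ y → + s ∣ z) → (+ s ∣ z → + s ∣ y) → ind s y ≡ ind s z
ind-⇔ s f g = cong (if_then 1 else 0)
  (does-⇔ (mk⇔ (λ d → ∣⇒∣ᵤ (f (∣ᵤ⇒∣ d))) (λ d → ∣⇒∣ᵤ (g (∣ᵤ⇒∣ d)))) (s ∣? _) (s ∣? _))

ind-∣ : ∀ s {z} → + s ∣ z → ind s z ≡ 1
ind-∣ s d = cong (if_then 1 else 0) (dec-true (s ∣? _) (∣⇒∣ᵤ d))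

ind-∤ : ∀ s {z} → ¬ (+ s ∣ z) → ind s z ≡ 0
ind-∤ s ¬d = cong (if_then 1 else 0) (dec-false (s ∣? _) (λ d → ¬d (∣ᵤ⇒∣ d)))

-- `rowCnt` splits off the last node of a row; moving the left end of an interval requires splitting
-- off the first.
rowCnt-bottom : ∀ s z n → rowCnt s z (suc n) ≡ ind s (z + 1ℤ) ℕ.+ rowCnt s (z + 1ℤ) n
rowCnt-bottom s z zero    = refl
rowCnt-bottom s z (suc n) = begin
  ind s (z + + suc (suc n)) ℕ.+ rowCnt s z (suc n)
    ≡⟨ cong₂ ℕ._+_ (cong (ind s) (lemma z (+ n))) (rowCnt-bottom s z n) ⟩
  ind s (z + 1ℤ + + suc n) ℕ.+ (ind s (z + 1ℤ) ℕ.+ rowCnt s (z + 1ℤ) n)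
    ≡⟨ x∙yz≈y∙xz (ind s (z + 1ℤ + + suc n)) (ind s (z + 1ℤ)) _ ⟩
  ind s (z + 1ℤ) ℕ.+ rowCnt s (z + 1ℤ) (suc n) ∎
  where
  open ≡-Reasoning
  open import Algebra.Properties.CommutativeSemigroup ℕₚ.+-commutativeSemigroup using (x∙yz≈y∙xz)
  lemma : ∀ z n → z + (+ 2 + n) ≡ z + 1ℤ + (1ℤ + n)
  lemma = solve-∀

-- ⌊ z / s ⌋, as the signed number of multiples of s in the interval ] 0 , z ].
quot : ℕ → ℤ → ℤ
quot s (+ n)    = + rowCnt s 0ℤ n
quot s -[1+ n ] = - (+ rowCnt s -[1+ n ] (suc n))

quot-suc : ∀ s z → quot s (z + 1ℤ) ≡ quot s z + + ind s (z + 1ℤ)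
quot-suc s (+ n) rewrite ℕₚ.+-comm n 1 = lemma (+ ind s (+ suc n)) (+ rowCnt s 0ℤ n)
  where
  lemma : ∀ i c → i + c ≡ c + i
  lemma = solve-∀
quot-suc s -[1+ zero ] = lemma (+ ind s 0ℤ)
  where
  lemma : ∀ i → 0ℤ ≡ - (i + 0ℤ) + i
  lemma = solve-∀
quot-suc s -[1+ suc n ] rewrite rowCnt-bottom s -[1+ suc n ] (suc n) = lemma (+ ind s -[1+ n ]) (+ rowCnt s -[1+ n ] (suc n))
  where
  lemma : ∀ i c → - c ≡ - (i + c) + i
  lemma = solve-∀

-- This is the bridge from nodes to beads: the count along a row depends only on the two ends of the
-- row.
quot-row : ∀ s z n → quot s (z + + n) ≡ quot s z + + rowCnt s z n
quot-row s z zero    = trans (cong (quot s) (ℤₚ.+-identityʳ z)) (sym (ℤₚ.+-identityʳ _))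
quot-row s z (suc n) = begin
  quot s (z + + suc n)                                    ≡⟨ cong (quot s) (lemma z (+ n)) ⟩
  quot s (z + + n + 1ℤ)                                   ≡⟨ quot-suc s (z + + n) ⟩
  quot s (z + + n) + + ind s (z + + n + 1ℤ)               ≡⟨ cong₂ (λ a b → a + + ind s b) (quot-row s z n) (sym (lemma z (+ n))) ⟩
  quot s z + + rowCnt s z n + + ind s (z + + suc n)       ≡⟨ lemma′ (quot s z) (+ rowCnt s z n) (+ ind s (z + + suc n)) ⟩
  quot s z + + rowCnt s z (suc n)                         ∎
  where
  open ≡-Reasoning
  lemma : ∀ z n → z + (1ℤ + n) ≡ z + n + 1ℤ
  lemma = solve-∀
  lemma′ : ∀ a b c → a + b + c ≡ a + (c + b)
  lemma′ = solve-∀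

ℤ-ind : (P : ℤ → Set) → P 0ℤ → (∀ z → P z → P (z + 1ℤ)) → (∀ z → P (z + 1ℤ) → P z) → ∀ z → P z
ℤ-ind P p up down (+ zero)  = p
ℤ-ind P p up down (+ suc n) = subst P (cong +_ (ℕₚ.+-comm n 1)) (up (+ n) (ℤ-ind P p up down (+ n)))
ℤ-ind P p up down -[1+ zero ]  = down -[1+ 0 ] p
ℤ-ind P p up down -[1+ suc n ] = down -[1+ suc n ] (ℤ-ind P p up down -[1+ n ])

-- The s + 1 positions after z are split at either end. The two end positions are s apart, so their
-- indicators agree and cancel.
rowCnt-period : ∀ s z → rowCnt s z s ≡ rowCnt s (z + 1ℤ) s
rowCnt-period s z = ℕₚ.+-cancelˡ-≡ (ind s (z + 1ℤ)) _ _ (begin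
  ind s (z + 1ℤ) ℕ.+ rowCnt s z s        ≡⟨ cong (ℕ._+ rowCnt s z s) (ind-⇔ s to from) ⟩
  ind s (z + + suc s) ℕ.+ rowCnt s z s   ≡⟨ rowCnt-bottom s z s ⟩
  ind s (z + 1ℤ) ℕ.+ rowCnt s (z + 1ℤ) s ∎)
  where
  open ≡-Reasoning
  lemma : ∀ z s → z + 1ℤ + s ≡ z + (1ℤ + s)
  lemma = solve-∀
  to : + s ∣ z + 1ℤ → + s ∣ z + + suc s
  to d = subst (+ s ∣_) (lemma z (+ s)) (∣m∣n⇒∣m+n d ∣-refl)
  from : + s ∣ z + + suc s → + s ∣ z + 1ℤ
  from d = ∣m+n∣n⇒∣m (subst (+ s ∣_) (sym (lemma z (+ s))) d) ∣-refl

rowCnt-0-< : ∀ s n → n ℕ.< s → rowCnt s 0ℤ n ≡ 0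
rowCnt-0-< s zero    _   = refl
rowCnt-0-< s (suc n) n<s = cong₂ ℕ._+_
  (ind-∤ s (λ d → ℕₚ.<⇒≱ n<s (ℕ∣.∣⇒≤ (∣⇒∣ᵤ {i = + suc n} d)))) (rowCnt-0-< s n (ℕₚ.<-trans ℕₚ.≤-refl n<s))

rowCnt-full : ∀ s .{{_ : ℕ.NonZero s}} z → rowCnt s z s ≡ 1
rowCnt-full s@(suc s-1) = ℤ-ind (λ z → rowCnt s z s ≡ 1)
  (cong₂ ℕ._+_ (ind-∣ s ∣-refl) (rowCnt-0-< s s-1 ℕₚ.≤-refl))
  (λ z eq → trans (sym (rowCnt-period s z)) eq)
  (λ z eq → trans (rowCnt-period s z) eq)

quot-+s : ∀ s .{{_ : ℕ.NonZero s}} z → quot s (z + + s) ≡ quot s z + 1ℤ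
quot-+s s z = trans (quot-row s z s) (cong (λ n → quot s z + + n) (rowCnt-full s z))

-- The bead of a row of length l lies l above the bead that the empty partition has in that place,
-- and `quot-row` turns this gap into the count of the row. The sum that remains depends on c and n
-- only and cancels whenever two bipartitions are compared.
beads-content : ∀ s r z a c ls n → length ls ℕ.≤ n → c - r ≡ z - + a →
  ∑ (beads c ls n) (λ x → quot s (x - r)) ≡ + partCnt s z a ls + ∑ (beads c [] n) (λ x → quot s (x - r))
beads-content s r z a c []       n       _         eq = sym (ℤₚ.+-identityˡ _)
beads-content s r z a c (l ∷ ls) (suc n) (s≤s len) eq = begin
  quot s (c - 1ℤ + + l - r) + ∑ (beads (c - 1ℤ) ls n) f
    ≡⟨ cong₂ _+_ (cong (quot s) (lemma₁ c (+ l) r)) (beads-content s r z (suc a) (c - 1ℤ) ls n len eq′) ⟩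
  quot s (c - 1ℤ - r + + l) + (+ partCnt s z (suc a) ls + V)
    ≡⟨ cong (λ q → q + (+ partCnt s z (suc a) ls + V)) (quot-row s (c - 1ℤ - r) l) ⟩
  quot s (c - 1ℤ - r) + + rowCnt s (c - 1ℤ - r) l + (+ partCnt s z (suc a) ls + V)
    ≡⟨ cong (λ y → quot s (c - 1ℤ - r) + + rowCnt s y l + (+ partCnt s z (suc a) ls + V)) eq′ ⟩
  quot s (c - 1ℤ - r) + + rowCnt s (z - + suc a) l + (+ partCnt s z (suc a) ls + V)
    ≡⟨ lemma₂ (quot s (c - 1ℤ - r)) (+ rowCnt s (z - + suc a) l) (+ partCnt s z (suc a) ls) V ⟩
  + partCnt s z a (l ∷ ls) + (quot s (c - 1ℤ - r) + V) ∎
  where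
  open ≡-Reasoning
  f : ℤ → ℤ
  f x = quot s (x - r)
  V : ℤ
  V = ∑ (beads (c - 1ℤ) [] n) f
  lemma₁ : ∀ c l r → c - 1ℤ + l - r ≡ c - 1ℤ - r + l
  lemma₁ = solve-∀
  lemma₂ : ∀ q w p v → q + w + (p + v) ≡ w + p + (q + v)
  lemma₂ = solve-∀
  lemma₃ : ∀ c r → c - 1ℤ - r ≡ c - r - 1ℤ
  lemma₃ = solve-∀
  lemma₄ : ∀ z a → z - a - 1ℤ ≡ z - (1ℤ + a)
  lemma₄ = solve-∀
  eq′ : c - 1ℤ - r ≡ z - + suc a
  eq′ = trans (lemma₃ c r) (trans (cong (λ y → y - 1ℤ) eq) (lemma₄ z (+ a)))

beads-countRes : ∀ s c₁ c₂ r l m n₁ n₂ → length l ℕ.≤ n₁ → length m ℕ.≤ n₂ →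
  ∑ (beads c₁ l n₁) (λ x → quot s (x - r)) + ∑ (beads c₂ m n₂) (λ x → quot s (x - r))
  ≡ + countRes s (c₁ , c₂) r (l , m)
    + (∑ (beads c₁ [] n₁) (λ x → quot s (x - r)) + ∑ (beads c₂ [] n₂) (λ x → quot s (x - r)))
beads-countRes s c₁ c₂ r l m n₁ n₂ len₁ len₂ = trans
  (cong₂ _+_ (beads-content s r (c₁ - r) 0 c₁ l n₁ len₁ (sym (ℤₚ.+-identityʳ _)))
             (beads-content s r (c₂ - r) 0 c₂ m n₂ len₂ (sym (ℤₚ.+-identityʳ _))))
  (lemma (+ partCnt s (c₁ - r) 0 l) (∑ (beads c₁ [] n₁) f) (+ partCnt s (c₂ - r) 0 m) (∑ (beads c₂ [] n₂) f))
  where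
  f : ℤ → ℤ
  f x = quot s (x - r)
  lemma : ∀ p v q w → p + v + (q + w) ≡ p + q + (v + w)
  lemma = solve-∀


common-base : ∀ c₁ c₂ k₁ k₂ zs →
  ∃ λ b → All (b ≤_) zs × (∃ λ n₁ → c₁ ≡ b + + n₁ × k₁ ℕ.≤ n₁) × (∃ λ n₂ → c₂ ≡ b + + n₂ × k₂ ℕ.≤ n₂)
common-base c₁ c₂ k₁ k₂ zs with lower-bound ((c₁ - + k₁) ∷ (c₂ - + k₂) ∷ zs)
... | b , b≤₁ ∷ b≤₂ ∷ b≤zs = b , b≤zs , split-charge c₁ k₁ b≤₁ , split-charge c₂ k₂ b≤₂

+-cancelʳ : ∀ i {j k} → j + i ≡ k + i → j ≡ k
+-cancelʳ i {j} {k} = ∙-cancelʳ i j k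

-- Both exchanges in one statement: e = k = 0 trades x and y between the components, while e = s, k
-- = 1 also shifts them. In the first component y - e takes the place of x, in the second x + e that
-- of y; one replacement raises `quot` by k and the other lowers it by k. The last conclusion
-- records that the bipartition has really changed.
swap : ∀ s e k c₁ c₂ {l m x y} → (∀ z → quot s (z + e) ≡ quot s z + k) → IsBipartition (l , m) →
       Bead c₁ l x → ¬ Bead c₂ m (x + e) → Bead c₂ m y → ¬ Bead c₁ l (y - e) →
       ∃ λ B → IsBipartition B × SameContent s (c₁ , c₂) (l , m) B × ¬ Bead c₁ (proj₁ B) x
swap s e k c₁ c₂ {l} {m} {x} {y} quot-+e (il , im) lx ¬mx my ¬ly
  with charge-replace (bead-charge il) lx ¬ly | charge-replace (bead-charge im) my ¬mx
... | l′ , il′ , l′-eq | m′ , im′ , m′-eq = (l′ , m′) , (il′ , im′) , same , gone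
  where
  gone : ¬ Bead c₁ l′ x
  gone bd with proj₂ l′-eq x bd
  ... | inj₁ eq        = ¬ly (subst (Bead c₁ l) eq lx)
  ... | inj₂ (_ , x≢x) = x≢x refl
  same : SameContent s (c₁ , c₂) (l , m) (l′ , m′)
  same r with common-base c₁ c₂ (length l ℕ.+ length l′) (length m ℕ.+ length m′) (x ∷ (y - e) ∷ y ∷ (x + e) ∷ [])
  ... | b , b≤x ∷ b≤y-e ∷ b≤y ∷ b≤x+e ∷ [] , (n₁ , refl , len₁) , (n₂ , refl , len₂) =
    ℤₚ.+-injective (+-cancelʳ (∑ (beads c₁ [] n₁) f + ∑ (beads c₂ [] n₂) f) (begin
      _ ≡⟨ sym (beads-countRes s c₁ c₂ r l m n₁ n₂ (ℕₚ.m+n≤o⇒m≤o _ len₁) (ℕₚ.m+n≤o⇒m≤o _ len₂)) ⟩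
      L + M                   ≡⟨ +-cancelˡ (f x + f y) (begin
        f x + f y + (L + M)                 ≡⟨ cong₂ (λ a b → a + b + (L + M)) (move x) (move′ y) ⟨
        f (x + e) - k + (f (y - e) + k) + (L + M) ≡⟨ lemma (f (x + e)) (f (y - e)) k L M ⟩
        (f (y - e) + L) + (f (x + e) + M)   ≡⟨ cong₂ _+_ (∑-↭ f l↭) (∑-↭ f m↭) ⟨
        (f x + L′) + (f y + M′)             ≡⟨ lemma′ (f x) (f y) L′ M′ ⟩
        f x + f y + (L′ + M′)               ∎) ⟩
      L′ + M′                 ≡⟨ beads-countRes s c₁ c₂ r l′ m′ n₁ n₂ (ℕₚ.m+n≤o⇒n≤o (length l) len₁) (ℕₚ.m+n≤o⇒n≤o (length m) len₂) ⟩
      _ ∎))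
    where
    open ≡-Reasoning
    f : ℤ → ℤ
    f x = quot s (x - r)
    L M L′ M′ : ℤ
    L = ∑ (beads c₁ l n₁) f
    M = ∑ (beads c₂ m n₂) f
    L′ = ∑ (beads c₁ l′ n₁) f
    M′ = ∑ (beads c₂ m′ n₂) f
    l↭ : x ∷ beads c₁ l′ n₁ ↭ (y - e) ∷ beads c₁ l n₁
    l↭ = replace-↭ lx ¬ly b≤x b≤y-e
      (beads-window b n₁ il (ℕₚ.m+n≤o⇒m≤o _ len₁) ≐-refl)
      (beads-window b n₁ il′ (ℕₚ.m+n≤o⇒n≤o (length l) len₁) l′-eq)
    m↭ : y ∷ beads c₂ m′ n₂ ↭ (x + e) ∷ beads c₂ m n₂
    m↭ = replace-↭ my ¬mx b≤y b≤x+e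
      (beads-window b n₂ im (ℕₚ.m+n≤o⇒m≤o _ len₂) ≐-refl)
      (beads-window b n₂ im′ (ℕₚ.m+n≤o⇒n≤o (length m) len₂) m′-eq)
    lemma : ∀ a b k l m → a - k + (b + k) + (l + m) ≡ b + l + (a + m)
    lemma = solve-∀
    lemma′ : ∀ a b l m → a + l + (b + m) ≡ a + b + (l + m)
    lemma′ = solve-∀
    lemma₁ : ∀ q k → q + k - k ≡ q
    lemma₁ = solve-∀
    lemma₂ : ∀ x e r → x + e - r ≡ x - r + e
    lemma₂ = solve-∀
    lemma₃ : ∀ y e r → y - e - r + e ≡ y - r
    lemma₃ = solve-∀
    move : ∀ x → f (x + e) - k ≡ f x
    move x = trans (cong (λ z → z - k) (trans (cong (quot s) (lemma₂ x e r)) (quot-+e (x - r)))) (lemma₁ (f x) k)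
    move′ : ∀ y → f (y - e) + k ≡ f y
    move′ y = trans (sym (quot-+e (y - e - r))) (cong (quot s) (lemma₃ y e r))

-- Cores as nested pairs of beta-sets

Nested : ℕ → (X Y : ℤ → Set) → Set
Nested s X Y = X ⊆′ Y × (∀ y → Y y → X (y - + s))

-- The pigeonhole principle needs one bound on a for each inclusion: 0 ≤ a to compare X with Y, and
-- a - s ≤ 0 to compare Y shifted down by s with X.
unique-content⇒nested : ∀ s a {l m} .{{_ : ℕ.NonZero s}} → a ℕ.< s → IsBipartition (l , m) →
  (∀ B → IsBipartition B → SameContent s (0ℤ , + a) (l , m) B → B ≡ (l , m)) →
  Nested s (Bead 0ℤ l) (Bead (+ a) m)
unique-content⇒nested s a {l} {m} a<s ib@(il , im) only = X⊆Y , Y-s⊆X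
  where
  hX : HasCharge 0ℤ (Bead 0ℤ l)
  hX = bead-charge il
  hY : HasCharge (+ a) (Bead (+ a) m)
  hY = bead-charge im
  no-swap : ∀ e k {x y} → (∀ z → quot s (z + e) ≡ quot s z + k) →
            Bead 0ℤ l x → ¬ Bead (+ a) m (x + e) → Bead (+ a) m y → ¬ Bead 0ℤ l (y - e) → ⊥
  no-swap e k q lx ¬mx my ¬ly with swap s e k 0ℤ (+ a) q ib lx ¬mx my ¬ly
  ... | B , iB , same , gone with refl ← only B iB same = gone lx
  X⊆Y : Bead 0ℤ l ⊆′ Bead (+ a) m
  X⊆Y x lx with bead? (+ a) m x
  ... | yes mx = mx
  ... | no ¬mx with charge-pigeonhole hX hY 0≤+ lx ¬mx
  ...   | y , my , ¬ly = ⊥-elim (no-swap 0ℤ 0ℤ (λ z → trans (cong (quot s) (ℤₚ.+-identityʳ z)) (sym (ℤₚ.+-identityʳ _)))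
            lx (λ bd → ¬mx (subst (Bead (+ a) m) (ℤₚ.+-identityʳ x) bd))
            my (λ bd → ¬ly (subst (Bead 0ℤ l) (ℤₚ.+-identityʳ y) bd)))
  Y-s⊆X : ∀ y → Bead (+ a) m y → Bead 0ℤ l (y - + s)
  Y-s⊆X y my with bead? 0ℤ l (y - + s)
  ... | yes ly = ly
  ... | no ¬ly with charge-pigeonhole (charge-shift (- + s) hY) hX a-s≤0
                      (subst (Bead (+ a) m) (lemma y (+ s)) my) ¬ly
    where
    lemma : ∀ y s → y ≡ y - s - - s
    lemma = solve-∀
    lemma′ : ∀ a s → 0ℤ ≡ a - s + (s - a)
    lemma′ = solve-∀
    a-s≤0 : + a - + s ≤ 0ℤ
    a-s≤0 = by≤ (gap≤ (+≤+ (ℕₚ.<⇒≤ a<s))) (lemma′ (+ a) (+ s))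
  ...   | x , lx , ¬mx = ⊥-elim (no-swap (+ s) 1ℤ (quot-+s s) lx
            (λ bd → ¬mx (subst (Bead (+ a) m) (lemma x (+ s)) bd)) my ¬ly)
    where
    lemma : ∀ x s → x + s ≡ x - - s
    lemma = solve-∀

-- Residue classes and their largest elements

module Modulo (s : ℕ) where

  infix 4 _≼_
  infix 5 _steps_
  record _≼_ (y u : ℤ) : Set where
    constructor _steps_
    field
      distance : ℕ
      equality : u ≡ y + + distance * + s

  ≼⇒≤ : ∀ {y u} → y ≼ u → y ≤ u
  ≼⇒≤ {y} (k steps refl) = by≤ (0≤+ {k ℕ.* s}) (cong (λ z → y + z) (sym (ℤₚ.pos-* k s)))

  infix 4 _≋_
  record _≋_ (u v : ℤ) : Set where
    constructor congruent
    field divides-diff : + s ∣ u - v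

  ≋-refl : ∀ {u} → u ≋ u
  ≋-refl {u} = congruent (divides 0ℤ (ℤₚ.+-inverseʳ u))

  ≋-sym : ∀ {u v} → u ≋ v → v ≋ u
  ≋-sym {u} {v} (congruent d) = congruent (subst (+ s ∣_) (lemma u v) (∣m⇒∣-m d))
    where
    lemma : ∀ u v → - (u - v) ≡ v - u
    lemma = solve-∀

  ≋-trans : ∀ {u v w} → u ≋ v → v ≋ w → u ≋ w
  ≋-trans {u} {v} {w} (congruent d) (congruent e) = congruent (subst (+ s ∣_) (lemma u v w) (∣m∣n⇒∣m+n d e))
    where
    lemma : ∀ u v w → u - v + (v - w) ≡ u - w
    lemma = solve-∀

  ≋-+ : ∀ {u v} k → u ≋ v → u + k ≋ v + k
  ≋-+ {u} {v} k (congruent d) = congruent (subst (+ s ∣_) (lemma u v k) d)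
    where
    lemma : ∀ u v k → u - v ≡ u + k - (v + k)
    lemma = solve-∀

  +k*s≋ : ∀ u k → u + k * + s ≋ u
  +k*s≋ u k = congruent (divides k (lemma u (k * + s)))
    where
    lemma : ∀ u d → u + d - u ≡ d
    lemma = solve-∀

  +s≋ : ∀ u → u + + s ≋ u
  +s≋ u = congruent (divides 1ℤ (lemma u (+ s)))
    where
    lemma : ∀ u s → u + s - u ≡ 1ℤ * s
    lemma = solve-∀

  ≼⇒≋ : ∀ {y u} → y ≼ u → u ≋ y
  ≼⇒≋ {y} (k steps refl) = +k*s≋ y (+ k)

  compare : ∀ y u → u ≋ y → y ≼ u ⊎ u + + s ≼ y
  compare y u (congruent (divides (+ k) eq)) = inj₁ (k steps trans (lemma u y) (cong (λ z → y + z) eq))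
    where
    lemma : ∀ u y → u ≡ y + (u - y)
    lemma = solve-∀
  compare y u (congruent (divides -[1+ k ] eq)) = inj₂ (k steps trans (lemma u y) (trans (cong (λ z → u - z) eq) (lemma′ u (+ k) (+ s))))
    where
    lemma : ∀ u y → y ≡ u - (u - y)
    lemma = solve-∀
    lemma′ : ∀ u k s → u - (- (1ℤ + k)) * s ≡ u + s + k * s
    lemma′ = solve-∀

  Closed : (ℤ → Set) → Set
  Closed P = ∀ y → P y → P (y - + s)

  closed-≼ : ∀ {P y u} → Closed P → y ≼ u → P u → P y
  closed-≼ {P} {y} cl (zero  steps refl) p = subst P (lemma y) p
    where
    lemma : ∀ y → y + 0ℤ ≡ y
    lemma = solve-∀
  closed-≼ {P} {y} cl (suc k steps refl) p = closed-≼ cl (k steps refl) (subst P (lemma y (+ k) (+ s)) (cl _ p))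
    where
    lemma : ∀ y k s → y + (1ℤ + k) * s - s ≡ y + k * s
    lemma = solve-∀

  -- For a `Closed` set this local condition says that u is the largest element in its residue
  -- class.
  Top : (ℤ → Set) → ℤ → Set
  Top P u = P u × ¬ P (u + + s)

  top-≼ : ∀ {P u y} → Closed P → Top P u → u ≋ y → P y → y ≼ u
  top-≼ {P} {u} {y} cl (_ , ¬pu) d p with compare y u d
  ... | inj₁ y≼u = y≼u
  ... | inj₂ u<y = ⊥-elim (¬pu (closed-≼ cl u<y p))

  top-unique : ∀ {P u v} → Closed P → Top P u → Top P v → u ≋ v → u ≡ v
  top-unique cl tu tv d = ℤₚ.≤-antisym (≼⇒≤ (top-≼ cl tv (≋-sym d) (proj₁ tu))) (≼⇒≤ (top-≼ cl tu d (proj₁ tv)))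

  above-top : ∀ {P u y} → Closed P → Top P u → u ≋ y → ¬ P y → u + + s ≤ y
  above-top {P} {u} {y} cl (pu , _) d ¬p with compare y u d
  ... | inj₁ y≼u = ⊥-elim (¬p (closed-≼ cl y≼u pu))
  ... | inj₂ u<y = ≼⇒≤ u<y

  module _ .{{_ : ℕ.NonZero s}} where

    archimedean : ∀ z → ∃ λ n → z ≤ + n * + s
    archimedean z = ∣ z ∣ , ℤₚ.≤-trans (i≤+∣i∣ z) (subst (+ ∣ z ∣ ≤_) (ℤₚ.pos-* ∣ z ∣ s) (+≤+ (ℕₚ.m≤m*n ∣ z ∣ s)))
      where
      i≤+∣i∣ : ∀ i → i ≤ + ∣ i ∣
      i≤+∣i∣ (+ n)    = ℤₚ.≤-refl
      i≤+∣i∣ -[1+ n ] = -≤+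

    -- The search climbs from v in steps of s; n bounds its length because the n-th step already
    -- leaves P.
    top-search : ∀ {P} → (∀ x → Dec (P x)) → ∀ n v → P v → ¬ P (v + + n * + s) → ∃ λ u → u ≋ v × Top P u
    top-search {P} P? zero    v p ¬p = ⊥-elim (¬p (subst P (lemma v) p))
      where
      lemma : ∀ v → v ≡ v + 0ℤ
      lemma = solve-∀
    top-search {P} P? (suc n) v p ¬p with P? (v + + s)
    ... | no ¬p+ = v , ≋-refl , p , ¬p+
    ... | yes p+ = let u , d , t = top-search P? n (v + + s) p+ (λ q → ¬p (subst P (lemma v (+ n) (+ s)) q)) in
                   u , ≋-trans d (+s≋ v) , t
      where
      lemma : ∀ v n s → v + s + n * s ≡ v + (1ℤ + n) * s
      lemma = solve-∀

    top-exists : ∀ {P c} → HasCharge c P → ∀ i → ∃ λ u → u ≋ i × Top P u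
    top-exists {P} {c} hc@(ls , _ , f , g) i with archimedean (i - (c - + length ls) + 1ℤ) | bead-bounded c ls
    ... | k , k-big | hi , below with archimedean (hi - (i - + k * + s))
    ...   | n , n-big = let u , d , t = top-search (charge-dec hc) n v (g v (bead-low c ls low)) (λ p → ℤₚ.<⇒≱ (below _ (f _ p)) high) in
                        u , ≋-trans d (subst (_≋ i) (lemma i (+ k) (+ s)) (+k*s≋ i (- + k))) , t
      where
      v : ℤ
      v = i - + k * + s
      lemma : ∀ i k s → i + - k * s ≡ i - k * s
      lemma = solve-∀
      low : v < c - + length ls
      low = by< (gap≤ k-big) (lemma₁ i (c - + length ls) (+ k * + s))
        where
        lemma₁ : ∀ i lo ks → lo ≡ 1ℤ + (i - ks) + (ks - (i - lo + 1ℤ))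
        lemma₁ = solve-∀
      high : hi ≤ v + + n * + s
      high = by≤ (gap≤ n-big) (lemma₁ hi v (+ n * + s))
        where
        lemma₁ : ∀ hi v ns → v + ns ≡ hi + (ns - (hi - v))
        lemma₁ = solve-∀

-- Bead sums determined by the content, and their minimisation

∑< : ℕ → (ℕ → ℤ) → ℤ
∑< zero    g = 0ℤ
∑< (suc n) g = ∑< n g + g n

∑<-zero : ∀ n {g} → (∀ i → i ℕ.< n → g i ≡ 0ℤ) → ∑< n g ≡ 0ℤ
∑<-zero zero    _ = refl
∑<-zero (suc n) z = cong₂ _+_ (∑<-zero n (λ i i<n → z i (ℕₚ.m<n⇒m<1+n i<n))) (z n ℕₚ.≤-refl)

∑<-single : ∀ n {g} j → j ℕ.< n → (∀ i → i ℕ.< n → i ≢ j → g i ≡ 0ℤ) → ∑< n g ≡ g j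
∑<-single (suc n) {g} j j<n z with j ℕₚ.≟ n
... | yes refl = trans (cong (λ a → a + g n) (∑<-zero n (λ i i<n → z i (ℕₚ.m<n⇒m<1+n i<n) (ℕₚ.<⇒≢ i<n)))) (ℤₚ.+-identityˡ _)
... | no j≢n   = trans (cong₂ _+_ (∑<-single n j (ℕₚ.≤∧≢⇒< (ℕ.s≤s⁻¹ j<n) j≢n) (λ i i<n → z i (ℕₚ.m<n⇒m<1+n i<n)))
                                  (z n ℕₚ.≤-refl (≢-sym j≢n))) (ℤₚ.+-identityʳ _)

∑<-telescope : ∀ n (g : ℤ → ℤ) x → ∑< n (λ r → g (x + 1ℤ - + r)) ≡ ∑< n (λ r → g (x - + r)) + g (x + 1ℤ) - g (x + 1ℤ - + n)
∑<-telescope zero    g x = trans (lemma (g (x + 1ℤ))) (cong (λ z → 0ℤ + g (x + 1ℤ) - g z) (sym (ℤₚ.+-identityʳ _)))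
  where
  lemma : ∀ a → 0ℤ ≡ 0ℤ + a - a
  lemma = solve-∀
∑<-telescope (suc n) g x = trans (cong (λ z → z + g (x + 1ℤ - + n)) (∑<-telescope n g x))
  (trans (lemma (∑< n (λ r → g (x - + r))) (g (x + 1ℤ)) (g (x + 1ℤ - + n)) (g (x - + n)))
         (cong (λ z → ∑< n (λ r → g (x - + r)) + g (x - + n) + g (x + 1ℤ) - g z) (lemma′ x (+ n))))
  where
  lemma : ∀ a b c d → a + b - c + c ≡ a + d + b - d
  lemma = solve-∀
  lemma′ : ∀ x n → x - n ≡ x + 1ℤ - (1ℤ + n)
  lemma′ = solve-∀

-- Hermite's identity for the floor function, with its constant left unevaluated. Raising x by 1
-- slides the range of arguments: the sum gains `quot s (x + 1)` and loses `quot s (x + 1 - s)`,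
-- which is smaller by 1.
hermite-identity : ∀ s .{{_ : ℕ.NonZero s}} x → ∑< s (λ r → quot s (x - + r)) ≡ x + ∑< s (λ r → quot s (0ℤ - + r))
hermite-identity s = ℤ-ind (λ x → H x ≡ x + H 0ℤ) (sym (ℤₚ.+-identityˡ _))
  (λ x eq → trans (step x) (trans (cong (λ z → z + 1ℤ) eq) (lemma x (H 0ℤ))))
  (λ x eq → +-cancelʳ 1ℤ (trans (sym (step x)) (trans eq (sym (lemma x (H 0ℤ))))))
  where
  H : ℤ → ℤ
  H x = ∑< s (λ r → quot s (x - + r))
  lemma : ∀ x h → x + h + 1ℤ ≡ x + 1ℤ + h
  lemma = solve-∀
  lemma₁ : ∀ h q → h + (q + 1ℤ) - q ≡ h + 1ℤ
  lemma₁ = solve-∀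
  lemma₂ : ∀ x s → x ≡ x - s + s
  lemma₂ = solve-∀
  step : ∀ x → H (x + 1ℤ) ≡ H x + 1ℤ
  step x = begin
    H (x + 1ℤ)                                           ≡⟨ ∑<-telescope s (quot s) x ⟩
    H x + quot s (x + 1ℤ) - quot s (x + 1ℤ - + s)        ≡⟨ cong (λ q → H x + q - quot s (x + 1ℤ - + s))
                                                              (trans (cong (quot s) (lemma₂ (x + 1ℤ) (+ s))) (quot-+s s (x + 1ℤ - + s))) ⟩
    H x + (quot s (x + 1ℤ - + s) + 1ℤ) - quot s (x + 1ℤ - + s) ≡⟨ lemma₁ (H x) _ ⟩
    H x + 1ℤ                                             ∎
    where open ≡-Reasoning

∑-negative : ∀ xs {U} → (∀ x → x ∈ xs → U x < 0ℤ) → ∑ xs U ≤ 0ℤ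
∑-negative []       neg = ℤₚ.≤-refl
∑-negative (x ∷ xs) neg = ℤₚ.+-mono-≤ (ℤₚ.<⇒≤ (neg x (here refl))) (∑-negative xs (λ y y∈ → neg y (there y∈)))

-- Compared with `xs`, the list `ys` omits only negative terms and adds only nonnegative ones. An
-- omission raises the sum strictly, but an addition may contribute 0, so equality of the sums
-- yields an inclusion and no more.
∑-minimal : ∀ {xs ys U} → Unique ys → (∀ x → x ∈ xs → U x < 0ℤ) → (∀ y → y ∈ ys → y ∉ xs → 0ℤ ≤ U y) →
            ∑ xs U ≤ ∑ ys U × (∑ xs U ≡ ∑ ys U → ∀ x → x ∈ xs → x ∈ ys)
∑-minimal {xs} {[]} {U} _ neg pos = ∑-negative xs neg , empty xs neg
  where
  empty : ∀ xs → (∀ x → x ∈ xs → U x < 0ℤ) → ∑ xs U ≡ 0ℤ → ∀ x → x ∈ xs → x ∈ []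
  empty (x ∷ xs) neg eq = ⊥-elim (ℤₚ.<-irrefl eq
    (ℤₚ.+-mono-<-≤ (neg x (here refl)) (∑-negative xs (λ y y∈ → neg y (there y∈)))))
∑-minimal {xs} {y ∷ ys} {U} (y∉ys ∷ uys) neg pos with y ∈? xs
... | yes y∈xs with ∈⇒↭∷ y∈xs
...   | zs , xs↭ = subst (_≤ U y + ∑ ys U) (sym ∑xs) (ℤₚ.+-monoʳ-≤ (U y) (proj₁ rec)) , λ eq x x∈ →
        λ-∷ (∈-resp-↭ xs↭ x∈) (proj₂ rec (+-cancelˡ (U y) (trans (sym ∑xs) eq)) x)
  where
  ∑xs : ∑ xs U ≡ U y + ∑ zs U
  ∑xs = ∑-↭ U xs↭
  rec : ∑ zs U ≤ ∑ ys U × (∑ zs U ≡ ∑ ys U → ∀ x → x ∈ zs → x ∈ ys)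
  rec = ∑-minimal uys (λ x x∈ → neg x (∈-resp-↭ (↭-sym xs↭) (there x∈)))
    (λ v v∈ v∉zs → pos v (there v∈) (λ v∈xs → v∉zs (∷-≢⇒∈ (∈-resp-↭ xs↭ v∈xs) (All.lookup y∉ys v∈))))
  λ-∷ : ∀ {x} → x ∈ y ∷ zs → (x ∈ zs → x ∈ ys) → x ∈ y ∷ ys
  λ-∷ (here eq)  _ = here eq
  λ-∷ (there x∈) f = there (f x∈)
∑-minimal {xs} {y ∷ ys} {U} (y∉ys ∷ uys) neg pos | no y∉xs =
  ℤₚ.≤-trans (proj₁ rec) ∑≤ , λ eq x x∈ → there (proj₂ rec (ℤₚ.≤-antisym (proj₁ rec) (subst (∑ ys U ≤_) (sym eq) ∑≤)) x x∈)
  where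
  rec : ∑ xs U ≤ ∑ ys U × (∑ xs U ≡ ∑ ys U → ∀ x → x ∈ xs → x ∈ ys)
  rec = ∑-minimal uys neg (λ v v∈ → pos v (there v∈))
  ∑≤ : ∑ ys U ≤ U y + ∑ ys U
  ∑≤ = by≤ (pos y (here refl) y∉xs) (ℤₚ.+-comm (U y) (∑ ys U))

-- To be used with Φ f saying that two bipartitions have the same bead sum of f; `one` then says
-- that they have equally many beads.
record LinearClosed (Φ : (ℤ → ℤ) → Set) : Set where
  field
    ext : ∀ {f g} → (∀ x → f x ≡ g x) → Φ f → Φ g
    add  : ∀ {f g} → Φ f → Φ g → Φ (λ x → f x + g x)
    mul  : ∀ {f} k → Φ f → Φ (λ x → k * f x)
    one  : Φ (λ _ → 1ℤ)

  const : ∀ k → Φ (λ _ → k)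
  const k = ext (λ _ → ℤₚ.*-identityʳ k) (mul k one)

  sub : ∀ {f g} → Φ f → Φ g → Φ (λ x → f x - g x)
  sub {f} {g} φf φg = ext (λ x → lemma (f x) (g x)) (add φf (mul -1ℤ φg))
    where
    lemma : ∀ a b → a + -1ℤ * b ≡ a - b
    lemma = solve-∀

  sum : ∀ n {f : ℕ → ℤ → ℤ} → (∀ i → Φ (f i)) → Φ (λ x → ∑< n (λ i → f i x))
  sum zero    φ = const 0ℤ
  sum (suc n) φ = add (sum n φ) (φ n)

module _ (s : ℕ) .{{_ : ℕ.NonZero s}} where
  open Modulo s

  residue-unique : ∀ {i j} → i ℕ.< s → j ℕ.< s → + j ≋ + i → i ≡ j
  residue-unique {i} {j} i<s j<s j≋i with compare (+ i) (+ j) j≋i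
  ... | inj₁ (k steps eq) = sym (small {k = k} j<s (ℤₚ.+-injective (trans eq (cong (λ z → + i + z) (sym (ℤₚ.pos-* k s))))))
    where
    small : ∀ {i j k} → j ℕ.< s → j ≡ i ℕ.+ k ℕ.* s → j ≡ i
    small {i} {k = zero}  _   eq = trans eq (ℕₚ.+-identityʳ i)
    small {i} {k = suc k} j<s refl = ⊥-elim (ℕₚ.<⇒≱ j<s (ℕₚ.≤-trans (ℕₚ.m≤m+n s (k ℕ.* s)) (ℕₚ.m≤n+m _ i)))
  ... | inj₂ j+s≼i = ⊥-elim (ℕₚ.<⇒≱ i<s (ℕₚ.≤-trans (ℕₚ.m≤n+m s j) (ℤₚ.drop‿+≤+ (≼⇒≤ j+s≼i))))

  classes : (ℕ → ℤ) → ℤ → ℤ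
  classes K x = K (x %ℕ s)

  classes-∑ : ∀ K x → ∑< s (λ i → K i * + ind s (x - + i)) ≡ classes K x
  classes-∑ K x = trans (∑<-single s (x %ℕ s) (n%ℕd<d x s) other) same
    where
    lemma₁ : ∀ r q → r + q - r ≡ q
    lemma₁ = solve-∀
    lemma₂ : ∀ x r i → x - i - (x - r) ≡ r - i
    lemma₂ = solve-∀
    x≋r : + s ∣ x - + (x %ℕ s)
    x≋r = divides (x /ℕ s) (trans (cong (λ z → z - + (x %ℕ s)) (a≡a%ℕn+[a/ℕn]*n x s)) (lemma₁ (+ (x %ℕ s)) _))
    same : K (x %ℕ s) * + ind s (x - + (x %ℕ s)) ≡ K (x %ℕ s)
    same = trans (cong (λ k → K (x %ℕ s) * + k) (ind-∣ s x≋r)) (ℤₚ.*-identityʳ _)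
    other : ∀ i → i ℕ.< s → i ≢ x %ℕ s → K i * + ind s (x - + i) ≡ 0ℤ
    other i i<s i≢ = trans (cong (λ k → K i * + k) (ind-∤ s {x - + i} λ (d : + s ∣ x - + i) →
      i≢ (residue-unique i<s (n%ℕd<d x s) (congruent (subst (+ s ∣_) (lemma₂ x (+ (x %ℕ s)) (+ i)) (∣m∣n⇒∣m-n {m = x - + i} d x≋r)))))) (ℤₚ.*-zeroʳ (K i))

  %ℕ-≋ : ∀ x → + (x %ℕ s) ≋ x
  %ℕ-≋ x = ≋-sym (subst (_≋ + (x %ℕ s)) (sym (a≡a%ℕn+[a/ℕn]*n x s)) (+k*s≋ (+ (x %ℕ s)) (x /ℕ s)))

  -- The difference of `quot` at r and at r + 1 is the indicator of the class of r, and combinations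
  -- of indicators give all of `classes K`. Summing `quot` over all r below s gives x up to a
  -- constant.
  content-span : ∀ {Φ} → LinearClosed Φ → (∀ r → Φ (λ x → quot s (x - r))) → Φ (λ x → x) × (∀ K → Φ (classes K))
  content-span {Φ} lc φ = identity , class
    where
    open LinearClosed lc
    lemma₁ : ∀ x h → x + h - h ≡ x
    lemma₁ = solve-∀
    lemma₂ : ∀ x r → x - (r + 1ℤ) + 1ℤ ≡ x - r
    lemma₂ = solve-∀
    lemma₃ : ∀ q i → q + i - q ≡ i
    lemma₃ = solve-∀
    identity : Φ (λ x → x)
    identity = ext (λ x → trans (cong (λ z → z - H) (hermite-identity s x)) (lemma₁ x H))
                 (sub (sum s (λ r → φ (+ r))) (const H))
      where
      H : ℤ
      H = ∑< s (λ r → quot s (0ℤ - + r))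
    indicator : ∀ r → Φ (λ x → + ind s (x - r))
    indicator r = ext (λ x → trans (cong (λ z → quot s z - quot s (x - (r + 1ℤ))) (sym (lemma₂ x r)))
        (trans (cong (λ z → z - quot s (x - (r + 1ℤ))) (quot-suc s (x - (r + 1ℤ))))
        (trans (lemma₃ (quot s (x - (r + 1ℤ))) _) (cong (λ z → + ind s z) (lemma₂ x r)))))
      (sub (φ r) (φ (r + 1ℤ)))
    class : ∀ K → Φ (classes K)
    class K = ext (classes-∑ K) (sum s (λ i → mul (K i) (indicator (+ i))))

  -- With K the sum of the two class tops, this is twice the distance from their midpoint, doubled
  -- since the midpoint need not be an integer. The - 1 makes the sign strict at a top: on X when
  -- the two tops coincide, on Y when they differ by s.
  potential : (ℕ → ℤ) → ℤ → ℤ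
  potential K x = + 2 * x - classes K x - 1ℤ

  -- With T and T′ the largest elements of Y and X in the residue class of a bead, the potentials
  -- 2y - (T + T′) - 1 - s on Y and 2x - (T + T′) - 1 on X are negative exactly on the beads of the nested
  -- pair, and the total potential depends on the content only.
  separating-potential : ∀ {X Y} → Nested s X Y →
    (∀ i → ∃ λ u → u ≋ i × Top X u) → (∀ i → ∃ λ u → u ≋ i × Top Y u) →
    ∃ λ K → ((∀ x → X x → potential K x < 0ℤ) × (∀ x → ¬ X x → 0ℤ ≤ potential K x)) ×
            ((∀ y → Y y → potential K y + - + s < 0ℤ) × (∀ y → ¬ Y y → 0ℤ ≤ potential K y + - + s))
  separating-potential {X} {Y} (X⊆Y , Y-s⊆X) topX topY =
    K , (X-neg , X-pos) , (Y-neg , Y-pos)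
    where
    closedX : Closed X
    closedX x p = Y-s⊆X x (X⊆Y x p)
    closedY : Closed Y
    closedY y p = X⊆Y _ (Y-s⊆X y p)
    T T′ : ℕ → ℤ
    T i = proj₁ (topY (+ i))
    T′ i = proj₁ (topX (+ i))
    T≋ : ∀ x → T (x %ℕ s) ≋ x
    T≋ x = ≋-trans (proj₁ (proj₂ (topY (+ (x %ℕ s))))) (%ℕ-≋ x)
    T′≋ : ∀ x → T′ (x %ℕ s) ≋ x
    T′≋ x = ≋-trans (proj₁ (proj₂ (topX (+ (x %ℕ s))))) (%ℕ-≋ x)
    T-top : ∀ i → Top Y (T i)
    T-top i = proj₂ (proj₂ (topY (+ i)))
    T′-top : ∀ i → Top X (T′ i)
    T′-top i = proj₂ (proj₂ (topX (+ i)))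
    T′≋T : ∀ i → T′ i ≋ T i
    T′≋T i = ≋-trans (proj₁ (proj₂ (topX (+ i)))) (≋-sym (proj₁ (proj₂ (topY (+ i)))))
    T′≤T : ∀ i → T′ i ≤ T i
    T′≤T i = ≼⇒≤ (top-≼ closedY (T-top i) (≋-sym (T′≋T i)) (X⊆Y _ (proj₁ (T′-top i))))
    T-s≤T′ : ∀ i → T i - + s ≤ T′ i
    T-s≤T′ i = ≼⇒≤ (top-≼ closedX (T′-top i) (≋-trans (T′≋T i) (subst (_≋ T i - + s) (lemma (T i) (+ s)) (+s≋ (T i - + s))))
                     (Y-s⊆X _ (proj₁ (T-top i))))
      where
      lemma : ∀ t s → t - s + s ≡ t
      lemma = solve-∀

    K : ℕ → ℤ
    K i = T i + T′ i
    1≤s : 0ℤ ≤ + s - 1ℤ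
    1≤s = gap≤ (+≤+ (ℕ.>-nonZero⁻¹ s))

    X-neg : ∀ x → X x → potential K x < 0ℤ
    X-neg x p = by< (gap≤ x≤T′ ⊕ gap≤ x≤T′ ⊕ gap≤ (T′≤T i)) (lemma x (T i) (T′ i))
      where
      i = x %ℕ s
      x≤T′ : x ≤ T′ i
      x≤T′ = ≼⇒≤ (top-≼ closedX (T′-top i) (T′≋ x) p)
      lemma : ∀ x t t′ → 0ℤ ≡ 1ℤ + (+ 2 * x - (t + t′) - 1ℤ) + (t′ - x + (t′ - x) + (t - t′))
      lemma = solve-∀
    X-pos : ∀ x → ¬ X x → 0ℤ ≤ potential K x
    X-pos x ¬p = by≤ (gap≤ x≥ ⊕ gap≤ x≥ ⊕ gap≤ (T-s≤T′ i) ⊕ 1≤s) (lemma x (T i) (T′ i) (+ s))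
      where
      i = x %ℕ s
      x≥ : T′ i + + s ≤ x
      x≥ = above-top closedX (T′-top i) (T′≋ x) ¬p
      lemma : ∀ x t t′ s → + 2 * x - (t + t′) - 1ℤ ≡ 0ℤ + (x - (t′ + s) + (x - (t′ + s)) + (t′ - (t - s)) + (s - 1ℤ))
      lemma = solve-∀
    Y-neg : ∀ y → Y y → potential K y + - + s < 0ℤ
    Y-neg y p = by< (gap≤ y≤T ⊕ gap≤ y≤T ⊕ gap≤ (T-s≤T′ i)) (lemma y (T i) (T′ i) (+ s))
      where
      i = y %ℕ s
      y≤T : y ≤ T i
      y≤T = ≼⇒≤ (top-≼ closedY (T-top i) (T≋ y) p)
      lemma : ∀ y t t′ s → 0ℤ ≡ 1ℤ + (+ 2 * y - (t + t′) - 1ℤ + - s) + (t - y + (t - y) + (t′ - (t - s)))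
      lemma = solve-∀
    Y-pos : ∀ y → ¬ Y y → 0ℤ ≤ potential K y + - + s
    Y-pos y ¬p = by≤ (gap≤ y≥ ⊕ gap≤ y≥ ⊕ gap≤ (T′≤T i) ⊕ 1≤s) (lemma y (T i) (T′ i) (+ s))
      where
      i = y %ℕ s
      y≥ : T i + + s ≤ y
      y≥ = above-top closedY (T-top i) (T≋ y) ¬p
      lemma : ∀ y t t′ s → + 2 * y - (t + t′) - 1ℤ + - s ≡ 0ℤ + (y - (t + s) + (y - (t + s)) + (t - t′) + (s - 1ℤ))
      lemma = solve-∀


  -- Each component of the nested pair has at most the potential sum of its counterpart, while the
  -- totals agree. Both inequalities are therefore equalities, and the equality case of `∑-minimal`
  -- gives the inclusion above the base; below the base everything is a bead.
  nested⇒⊆ : ∀ {c₁ c₂ l m l′ m′} → IsBipartition (l , m) → IsBipartition (l′ , m′) →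
             Nested s (Bead c₁ l) (Bead c₂ m) → SameContent s (c₁ , c₂) (l , m) (l′ , m′) →
             Bead c₁ l ⊆′ Bead c₁ l′ × Bead c₂ m ⊆′ Bead c₂ m′
  nested⇒⊆ {c₁} {c₂} {l} {m} {l′} {m′} (il , im) (il′ , im′) nested same
    with common-base c₁ c₂ (length l ℕ.+ length l′) (length m ℕ.+ length m′) []
  ... | b , [] , (n₁ , refl , len₁) , (n₂ , refl , len₂) =
      extend lenl lenl′ (proj₂ minX eqX) , extend lenm lenm′ (proj₂ minY eqY)
    where
    X Y : ℤ → Set
    X = Bead c₁ l
    Y = Bead c₂ m
    lenl = ℕₚ.m+n≤o⇒m≤o (length l) len₁
    lenl′ = ℕₚ.m+n≤o⇒n≤o (length l) len₁
    lenm = ℕₚ.m+n≤o⇒m≤o (length m) len₂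
    lenm′ = ℕₚ.m+n≤o⇒n≤o (length m) len₂
    xs = beads c₁ l n₁
    ys = beads c₂ m n₂
    xs′ = beads c₁ l′ n₁
    ys′ = beads c₂ m′ n₂

    Agree : (ℤ → ℤ) → Set
    Agree f = ∑ xs f + ∑ ys f ≡ ∑ xs′ f + ∑ ys′ f

    agree-linear : LinearClosed Agree
    agree-linear = record
      { ext = λ {f} {g} eq ag → trans (sym (cong₂ _+_ (∑-cong xs eq) (∑-cong ys eq)))
                                   (trans ag (cong₂ _+_ (∑-cong xs′ eq) (∑-cong ys′ eq)))
      ; add  = λ {f} {g} af ag → trans (cong₂ _+_ (∑-+ xs f g) (∑-+ ys f g))
                 (trans (lemma₁ (∑ xs f) (∑ xs g) (∑ ys f) (∑ ys g)) (trans (cong₂ _+_ af ag)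
                 (trans (lemma₁ (∑ xs′ f) (∑ ys′ f) (∑ xs′ g) (∑ ys′ g)) (sym (cong₂ _+_ (∑-+ xs′ f g) (∑-+ ys′ f g))))))
      ; mul  = λ {f} k af → trans (cong₂ _+_ (∑-* xs k f) (∑-* ys k f)) (trans (lemma₂ k (∑ xs f) (∑ ys f))
                 (trans (cong (λ z → k * z) af) (trans (sym (lemma₂ k (∑ xs′ f) (∑ ys′ f)))
                 (sym (cong₂ _+_ (∑-* xs′ k f) (∑-* ys′ k f))))))
      ; one  = cong₂ _+_ (∑-one l l′ c₁ n₁) (∑-one m m′ c₂ n₂)
      }
      where
      lemma₁ : ∀ a b c d → a + b + (c + d) ≡ a + c + (b + d)
      lemma₁ = solve-∀
      lemma₂ : ∀ k a b → k * a + k * b ≡ k * (a + b)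
      lemma₂ = solve-∀
      ∑-one : ∀ l l′ c n → ∑ (beads c l n) (λ _ → 1ℤ) ≡ ∑ (beads c l′ n) (λ _ → 1ℤ)
      ∑-one l l′ c n = trans (∑-const (beads c l n) 1ℤ) (trans (cong (λ k → + k * 1ℤ)
        (trans (length-beads c l n) (sym (length-beads c l′ n)))) (sym (∑-const (beads c l′ n) 1ℤ)))

    agree-quot : ∀ r → Agree (λ x → quot s (x - r))
    agree-quot r = trans (beads-countRes s c₁ c₂ r l m n₁ n₂ lenl lenm)
      (trans (cong (λ k → + k + (∑ (beads c₁ [] n₁) (λ x → quot s (x - r)) + ∑ (beads c₂ [] n₂) (λ x → quot s (x - r)))) (same r)) (sym (beads-countRes s c₁ c₂ r l′ m′ n₁ n₂ lenl′ lenm′)))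

    topX : ∀ i → ∃ λ u → u ≋ i × Top X u
    topX = top-exists (bead-charge il)
    topY : ∀ i → ∃ λ u → u ≋ i × Top Y u
    topY = top-exists (bead-charge im)
    sep = separating-potential {X} {Y} nested topX topY
    K : ℕ → ℤ
    K = proj₁ sep
    U : ℤ → ℤ
    U = potential K
    X-neg = proj₁ (proj₁ (proj₂ sep))
    X-pos = proj₂ (proj₁ (proj₂ sep))
    Y-neg = proj₁ (proj₂ (proj₂ sep))
    Y-pos = proj₂ (proj₂ (proj₂ sep))
    agree-U : Agree U
    agree-U = sub (sub (mul (+ 2) (proj₁ span)) (proj₂ span K)) one
      where
      open LinearClosed agree-linear
      span = content-span agree-linear agree-quot

    wx = beads-window b n₁ il lenl ≐-refl
    wy = beads-window b n₂ im lenm ≐-refl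
    wx′ = beads-window b n₁ il′ lenl′ ≐-refl
    wy′ = beads-window b n₂ im′ lenm′ ≐-refl

    minX : ∑ xs U ≤ ∑ xs′ U × (∑ xs U ≡ ∑ xs′ U → ∀ x → x ∈ xs → x ∈ xs′)
    minX = ∑-minimal (Window.unique wx′) (λ x x∈ → X-neg x (proj₁ (Window.sound wx x x∈)))
      (λ x x∈ x∉ → X-pos x (λ p → x∉ (Window.complete wx x p (proj₂ (Window.sound wx′ x x∈)))))
    V : ℤ → ℤ
    V y = U y + - + s
    minY : ∑ ys V ≤ ∑ ys′ V × (∑ ys V ≡ ∑ ys′ V → ∀ y → y ∈ ys → y ∈ ys′)
    minY = ∑-minimal (Window.unique wy′) (λ y y∈ → Y-neg y (proj₁ (Window.sound wy y y∈)))
      (λ y y∈ y∉ → Y-pos y (λ p → y∉ (Window.complete wy y p (proj₂ (Window.sound wy′ y y∈)))))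

    -- The shift by - s in V adds the same constant for both bipartitions, as each second component
    -- has n₂ beads in the window.
    ∑V : ∀ m → ∑ (beads c₂ m n₂) V ≡ ∑ (beads c₂ m n₂) U + + n₂ * - + s
    ∑V m = trans (∑-+ (beads c₂ m n₂) U (λ _ → - + s)) (cong (λ z → ∑ (beads c₂ m n₂) U + z)
      (trans (∑-const (beads c₂ m n₂) (- + s)) (cong (λ k → + k * - + s) (length-beads c₂ m n₂))))
    total : ∑ xs U + ∑ ys V ≡ ∑ xs′ U + ∑ ys′ V
    total = trans (cong (λ z → ∑ xs U + z) (∑V m)) (trans (sym (ℤₚ.+-assoc (∑ xs U) _ _))
      (trans (cong (λ z → z + + n₂ * - + s) agree-U) (trans (ℤₚ.+-assoc (∑ xs′ U) _ _) (cong (λ z → ∑ xs′ U + z) (sym (∑V m′))))))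
    squeeze : ∀ {p q p′ q′} → p ≤ p′ → q ≤ q′ → p + q ≡ p′ + q′ → p ≡ p′
    squeeze {p} {q} {p′} {q′} p≤ q≤ eq = ℤₚ.≤-antisym p≤ (by≤ (gap≤ q≤) (trans (lemma p q) (trans (cong (λ z → z - q) eq) (lemma′ p′ q q′))))
      where
      lemma : ∀ p q → p ≡ p + q - q
      lemma = solve-∀
      lemma′ : ∀ p q q′ → p + q′ - q ≡ p + (q′ - q)
      lemma′ = solve-∀
    eqX : ∑ xs U ≡ ∑ xs′ U
    eqX = squeeze (proj₁ minX) (proj₁ minY) total
    eqY : ∑ ys V ≡ ∑ ys′ V
    eqY = squeeze (proj₁ minY) (proj₁ minX) (trans (ℤₚ.+-comm (∑ ys V) (∑ xs U)) (trans total (ℤₚ.+-comm (∑ xs′ U) (∑ ys′ V))))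

    extend : ∀ {n k k′} → length k ℕ.≤ n → length k′ ℕ.≤ n →
             (∀ x → x ∈ beads (b + + n) k n → x ∈ beads (b + + n) k′ n) →
             Bead (b + + n) k ⊆′ Bead (b + + n) k′
    extend {n} {k} {k′} len len′ sub x p with b ℤₚ.≤? x
    ... | yes b≤x = ∈-beads⇒Bead _ k′ n (sub x (Bead⇒∈-beads b n k len b≤x p))
    ... | no b≰x  = bead-low _ k′ (ℤₚ.<-≤-trans (ℤₚ.≰⇒> b≰x) (by≤ (gap≤ (+≤+ len′)) (lemma b (+ n) (+ length k′))))
      where
      lemma : ∀ b n k → b + n - k ≡ b + (n - k)
      lemma = solve-∀

-- At equal charges `charge-pigeonhole` rules out a proper inclusion.
⊆⇒≡ : ∀ {c l l′} → IsPartition l → IsPartition l′ → Bead c l ⊆′ Bead c l′ → l′ ≡ l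
⊆⇒≡ {c} {l} {l′} il il′ sub = bead-injective c il′ il (back , sub)
  where
  back : Bead c l′ ⊆′ Bead c l
  back x p with bead? c l x
  ... | yes q = q
  ... | no ¬q with charge-pigeonhole (bead-charge il′) (bead-charge il) ℤₚ.≤-refl p ¬q
  ...   | y , q , ¬p = ⊥-elim (¬p (sub y q))

nested⇒unique-content : ∀ s .{{_ : ℕ.NonZero s}} c₁ c₂ {B} → IsBipartition B →
  Nested s (Bead c₁ (proj₁ B)) (Bead c₂ (proj₂ B)) →
  ∀ B′ → IsBipartition B′ → SameContent s (c₁ , c₂) B B′ → B′ ≡ B
nested⇒unique-content s c₁ c₂ ib nested B′ ib′ same =
  let X⊆ , Y⊆ = nested⇒⊆ s ib ib′ nested same
  in cong₂ _,_ (⊆⇒≡ (proj₁ ib) (proj₁ ib′) X⊆) (⊆⇒≡ (proj₂ ib) (proj₂ ib′) Y⊆)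

pred<self : ∀ x → x - 1ℤ < x
pred<self x = by< (0≤+ {0}) (lemma x)
  where
  lemma : ∀ x → x ≡ 1ℤ + (x - 1ℤ) + 0ℤ
  lemma = solve-∀

pred≢self : ∀ x → x - 1ℤ ≢ x
pred≢self x eq = ℤₚ.<-irrefl eq (pred<self x)

≮-below : ∀ d l → ¬ (d + + suc l - 1ℤ < d)
≮-below d l x< = absurd (gap< x< ⊕ 0≤+ {l}) (lemma d (+ l))
  where
  lemma : ∀ d l → d - (1ℤ + (d + (1ℤ + l) - 1ℤ)) + l ≡ -1ℤ
  lemma = solve-∀

¬bead-pred-top : ∀ c l {x} → x ≡ c - 1ℤ + + suc l → ¬ Bead c (suc l ∷ []) (x - 1ℤ)
¬bead-pred-top c l {x} x≡ =
  Sum.[ (λ eq → pred≢self x (trans eq (sym x≡))) , (λ x< → ≮-below (c - 1ℤ) l (subst (λ x → x - 1ℤ < c - 1ℤ) x≡ x<)) ]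

-- By induction the tail is empty, and a single row of positive length leaves a gap just below its
-- top bead.
1-closed⇒[] : ∀ c {ls} → IsPartition ls → (∀ x → Bead c ls x → Bead c ls (x - 1ℤ)) → ls ≡ []
1-closed⇒[] c {[]}     _  _  = refl
1-closed⇒[] c {zero ∷ ls}  (_ , () ∷ _) _
1-closed⇒[] c {suc l ∷ ls} ip@(lk , _) cl =
  ⊥-elim (impossible (1-closed⇒[] (c - 1ℤ) (partition-tail ip) (λ x bd → tail x bd (cl x (inj₂ bd)))))
  where
  tail : ∀ x → Bead (c - 1ℤ) ls x → Bead c (suc l ∷ ls) (x - 1ℤ) → Bead (c - 1ℤ) ls (x - 1ℤ)
  tail x bd (inj₂ bd′) = bd′
  tail x bd (inj₁ eq)  = ⊥-elim (ℤₚ.<-irrefl eq (ℤₚ.<-trans (pred<self x) (bead<top c lk bd)))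
  impossible : ls ≢ []
  impossible refl = ¬bead-pred-top c l refl (cl _ (inj₁ refl))

-- The convention for s = 1 agrees with nestedness: both beta-sets are then closed under subtraction
-- of 1, so both partitions are empty.
nested⇒core : ∀ s a {B} → a ℕ.< s → IsBipartition B →
              Nested s (Bead 0ℤ (proj₁ B)) (Bead (+ a) (proj₂ B)) → IsCore s (0ℤ , + a) B
nested⇒core (suc zero) a _ (il , im) (X⊆Y , Y-1⊆X) =
  cong₂ _,_ (1-closed⇒[] 0ℤ il (λ x p → Y-1⊆X x (X⊆Y x p))) (1-closed⇒[] (+ a) im (λ y p → X⊆Y _ (Y-1⊆X y p)))
nested⇒core s@(suc (suc _)) a _ ib nested = nested⇒unique-content s 0ℤ (+ a) ib nested

core⇒nested : ∀ s a {B} → a ℕ.< s → IsBipartition B → IsCore s (0ℤ , + a) B →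
              Nested s (Bead 0ℤ (proj₁ B)) (Bead (+ a) (proj₂ B))
-- Here a = 0, and both beta-sets consist of the negative integers.
core⇒nested (suc zero) zero    _ _ refl = (λ _ p → p) , λ y y< → by< (gap< y< ⊕ 0≤+ {1}) (lemma y)
  where
  lemma : ∀ y → 0ℤ ≡ 1ℤ + (y - 1ℤ) + (0ℤ - (1ℤ + y) + 1ℤ)
  lemma = solve-∀
core⇒nested (suc zero) (suc a) (s≤s ()) _ _
core⇒nested s@(suc (suc _)) a a<s ib core = unique-content⇒nested s a a<s ib core

-- Lattice paths

-- Instructions for a closed path: E moves from v ∈ X to v + t, D moves from v ∈ Y ∖ X to v + t - s,
-- and N moves from v ∉ Y to v - s.
data Word : ℕ → ℕ → ℕ → Set where
  []  : Word 0 0 0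
  D∷_ : ∀ {a e b} → Word a e b → Word (suc a) e b
  E∷_ : ∀ {a e b} → Word a e b → Word a (suc e) b
  N∷_ : ∀ {a e b} → Word a e b → Word a e (suc b)

module Path (s t : ℕ) where
  open Modulo s

  end : ∀ {a e b} → ℤ → Word a e b → ℤ
  end v []     = v
  end v (D∷ w) = end (v + + t - + s) w
  end v (E∷ w) = end (v + + t) w
  end v (N∷ w) = end (v - + s) w

  Mark : Set
  Mark = ℤ × ℤ

  -- The largest elements of Y and of X in the residue classes mod s visited by the path.
  marks : ∀ {a e b} → ℤ → Word a e b → List Mark
  marks v []     = []
  marks v (D∷ w) = (v , v - + s) ∷ marks (v + + t - + s) w
  marks v (E∷ w) = (v , v) ∷ marks (v + + t) w
  marks v (N∷ w) = marks (v - + s) w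

  -- When the marks lie in distinct classes, these are the elements of Y outside X; their number a
  -- is thus the difference of the charges.
  diagonals : ∀ {a e b} → ℤ → Word a e b → List ℤ
  diagonals v []     = []
  diagonals v (D∷ w) = v ∷ diagonals (v + + t - + s) w
  diagonals v (E∷ w) = diagonals (v + + t) w
  diagonals v (N∷ w) = diagonals (v - + s) w

  length-diagonals : ∀ {a e b} v (w : Word a e b) → length (diagonals v w) ≡ a
  length-diagonals v []     = refl
  length-diagonals v (D∷ w) = cong suc (length-diagonals _ w)
  length-diagonals v (E∷ w) = length-diagonals _ w
  length-diagonals v (N∷ w) = length-diagonals _ w

  end-formula : ∀ {a e b} v (w : Word a e b) → end v w ≡ v + (+ a + + e) * + t - (+ a + + b) * + s
  end-formula v [] = lemma v (+ t) (+ s)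
    where
    lemma : ∀ v t s → v ≡ v + 0ℤ * t - 0ℤ * s
    lemma = solve-∀
  end-formula {suc a} {e} {b} v (D∷ w) = trans (end-formula _ w) (lemma v (+ t) (+ s) (+ a) (+ e) (+ b))
    where
    lemma : ∀ v t s a e b → v + t - s + (a + e) * t - (a + b) * s ≡ v + (1ℤ + a + e) * t - (1ℤ + a + b) * s
    lemma = solve-∀
  end-formula {a} {suc e} {b} v (E∷ w) = trans (end-formula _ w) (lemma v (+ t) (+ s) (+ a) (+ e) (+ b))
    where
    lemma : ∀ v t s a e b → v + t + (a + e) * t - (a + b) * s ≡ v + (a + (1ℤ + e)) * t - (a + b) * s
    lemma = solve-∀
  end-formula {a} {e} {suc b} v (N∷ w) = trans (end-formula _ w) (lemma v (+ t) (+ s) (+ a) (+ e) (+ b))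
    where
    lemma : ∀ v t s a e b → v - s + (a + e) * t - (a + b) * s ≡ v + (a + e) * t - (a + (1ℤ + b)) * s
    lemma = solve-∀

  InY InX : List Mark → ℤ → Set
  InY ms y = Any (λ m → y ≼ proj₁ m) ms
  InX ms x = Any (λ m → x ≼ proj₂ m) ms

  -- This is s-nestedness within one residue class, expressed by the two tops.
  Adjacent : Mark → Set
  Adjacent (u , x) = x ≡ u ⊎ x ≡ u - + s

  marks-adjacent : ∀ {a e b} v (w : Word a e b) → All Adjacent (marks v w)
  marks-adjacent v []     = []
  marks-adjacent v (D∷ w) = inj₂ refl ∷ marks-adjacent _ w
  marks-adjacent v (E∷ w) = inj₁ refl ∷ marks-adjacent _ w
  marks-adjacent v (N∷ w) = marks-adjacent _ w

  ≼-refl : ∀ {y} → y ≼ y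
  ≼-refl {y} = 0 steps sym (ℤₚ.+-identityʳ y)

  ≼-trans : ∀ {x y z} → x ≼ y → y ≼ z → x ≼ z
  ≼-trans {x} (j steps refl) (k steps refl) = j ℕ.+ k steps lemma x (+ j) (+ k) (+ s)
    where
    lemma : ∀ x j k s → x + j * s + k * s ≡ x + (j + k) * s
    lemma = solve-∀

  ≼-plus : ∀ {x y} k → x ≼ y → x + k ≼ y + k
  ≼-plus {x} k (j steps refl) = j steps lemma x k (+ j * + s)
    where
    lemma : ∀ x k d → x + d + k ≡ x + k + d
    lemma = solve-∀

  ≼-minus : ∀ {x y} k → x ≼ y → x - k ≼ y - k
  ≼-minus k = ≼-plus (- k)

  -s≼ : ∀ x → x - + s ≼ x
  -s≼ x = 1 steps lemma x (+ s)
    where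
    lemma : ∀ x s → x ≡ x - s + 1ℤ * s
    lemma = solve-∀

  ≼? : ∀ y u → Dec (y ≼ u)
  ≼? y u with u - y in eq
  ... | -[1+ n ] = no λ le → case≤ (subst (0ℤ ≤_) eq (gap≤ (≼⇒≤ le)))
    where
    case≤ : ¬ (0ℤ ≤ -[1+ n ])
    case≤ ()
  ... | + n with s ∣? n
  ...   | no ¬d = no λ { (k steps refl) → ¬d (ℕ∣.divides k (ℤₚ.+-injective (trans (sym eq) (trans (lemma y (+ k * + s)) (sym (ℤₚ.pos-* k s)))))) }
    where
    lemma : ∀ y d → y + d - y ≡ d
    lemma = solve-∀
  ...   | yes (ℕ∣.divides k refl) = yes (k steps trans (lemma u y) (cong (λ z → y + z) (trans eq (ℤₚ.pos-* k s))))
    where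
    lemma : ∀ u y → u ≡ y + (u - y)
    lemma = solve-∀

  adjacent-≼ : ∀ {u x} → Adjacent (u , x) → x ≼ u
  adjacent-≼     (inj₁ refl) = ≼-refl
  adjacent-≼ {u} (inj₂ refl) = -s≼ u

  adjacent-s≼ : ∀ {u x} → Adjacent (u , x) → u - + s ≼ x
  adjacent-s≼ {u} (inj₁ refl) = -s≼ u
  adjacent-s≼     (inj₂ refl) = ≼-refl

  nested-s : ∀ {ms} → All Adjacent ms → Nested s (InX ms) (InY ms)
  nested-s {ms} adj = X⊆Y , Y-s⊆X
    where
    X⊆Y : InX ms ⊆′ InY ms
    X⊆Y x p = let m , m∈ , x≼ = find p in lose m∈ (≼-trans x≼ (adjacent-≼ (All.lookup adj m∈)))
    Y-s⊆X : ∀ y → InY ms y → InX ms (y - + s)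
    Y-s⊆X y p = let m , m∈ , y≼ = find p in lose m∈ (≼-trans (≼-minus (+ s) y≼) (adjacent-s≼ (All.lookup adj m∈)))

  module _ (ms : List Mark) where

    -- The condition that t-nestedness imposes on v if v lies in Y. It is stated for every vertex so
    -- that it can be carried along the walk.
    Reached : ℤ → Set
    Reached v = InX ms (v - + t)

    reached-s : ∀ {v} → Reached v → Reached (v - + s)
    reached-s {v} = Any.map (λ r → ≼-trans (≼-minus (+ t) (-s≼ v)) r)

    reached-E : ∀ {v} → (v , v) ∈ ms → Reached (v + + t)
    reached-E {v} m∈ = lose m∈ (subst (_≼ v) (lemma v (+ t)) ≼-refl)
      where
      lemma : ∀ v t → v ≡ v + t - t
      lemma = solve-∀

    reached-D : ∀ {v} → (v , v - + s) ∈ ms → Reached (v + + t - + s)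
    reached-D {v} m∈ = lose m∈ (subst (_≼ v - + s) (lemma v (+ t) (+ s)) ≼-refl)
      where
      lemma : ∀ v t s → v - s ≡ v + t - s - t
      lemma = solve-∀

    -- An E or D step creates the property at the vertex to which it leads, and an N step, a move by
    -- - s, preserves it.
    reached-all : ∀ {a e b} v (w : Word a e b) → (∀ {m} → m ∈ marks v w → m ∈ ms) → Reached v →
                  All (λ m → Reached (proj₁ m)) (marks v w) × Reached (end v w)
    reached-all v []     sub r = [] , r
    reached-all v (D∷ w) sub r = let rs , re = reached-all _ w (λ m∈ → sub (there m∈)) (reached-D (sub (here refl))) in r ∷ rs , re
    reached-all v (E∷ w) sub r = let rs , re = reached-all _ w (λ m∈ → sub (there m∈)) (reached-E (sub (here refl))) in r ∷ rs , re
    reached-all v (N∷ w) sub r = reached-all _ w sub (reached-s {v} r)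

    reached-end : ∀ {a e b} v (w : Word a e b) → (∀ {m} → m ∈ marks v w → m ∈ ms) → a ℕ.+ e ≢ 0 → Reached (end v w)
    reached-end v []     sub ≢0 = ⊥-elim (≢0 refl)
    reached-end v (D∷ w) sub _  = proj₂ (reached-all _ w (λ m∈ → sub (there m∈)) (reached-D (sub (here refl))))
    reached-end v (E∷ w) sub _  = proj₂ (reached-all _ w (λ m∈ → sub (there m∈)) (reached-E (sub (here refl))))
    reached-end v (N∷ w) sub ≢0 = reached-end _ w sub ≢0

  -- The first E or D step makes the end of the walk `Reached`. The end is also the start, so the
  -- property travels round a second time and arrives at every mark.
  nested-t : ∀ {a e b} v (w : Word a e b) → a ℕ.+ e ≢ 0 → end v w ≡ v → Nested t (InX (marks v w)) (InY (marks v w))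
  nested-t v w ≢0 closed = proj₁ (nested-s (marks-adjacent v w)) , Y-t⊆X
    where
    ms = marks v w
    all-reached : All (λ m → Reached ms (proj₁ m)) ms
    all-reached = proj₁ (reached-all ms v w (λ m∈ → m∈) (subst (Reached ms) closed (reached-end ms v w (λ m∈ → m∈) ≢0)))
    Y-t⊆X : ∀ y → InY ms y → InX ms (y - + t)
    Y-t⊆X y p = let m , m∈ , y≼ = find p in
      Any.map (λ u-t≼ → ≼-trans (≼-minus (+ t) y≼) u-t≼) (All.lookup all-reached m∈)

  index-zero : ∀ {v} → v ≋ v + 0ℤ * + t
  index-zero {v} = subst (v ≋_) (lemma v (+ t)) ≋-refl
    where
    lemma : ∀ v t → v ≡ v + 0ℤ * t
    lemma = solve-∀

  index-D : ∀ {u v j} → u ≋ v + + t - + s + + j * + t → u ≋ v + + suc j * + t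
  index-D {u} {v} {j} c = ≋-trans c (subst (_≋ v + + suc j * + t) (lemma v (+ j) (+ t) (+ s)) (+k*s≋ _ -1ℤ))
    where
    lemma : ∀ v j t s → v + (1ℤ + j) * t + -1ℤ * s ≡ v + t - s + j * t
    lemma = solve-∀

  index-E : ∀ {u v j} → u ≋ v + + t + + j * + t → u ≋ v + + suc j * + t
  index-E {u} {v} {j} = subst (u ≋_) (lemma v (+ j) (+ t))
    where
    lemma : ∀ v j t → v + t + j * t ≡ v + (1ℤ + j) * t
    lemma = solve-∀

  index-N : ∀ {u v j} → u ≋ v - + s + + j * + t → u ≋ v + + j * + t
  index-N {u} {v} {j} c = ≋-trans c (subst (_≋ v + + j * + t) (lemma v (+ j) (+ t) (+ s)) (+k*s≋ _ -1ℤ))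
    where
    lemma : ∀ v j t s → v + j * t + -1ℤ * s ≡ v - s + j * t
    lemma = solve-∀

  -- Modulo s an E or D step adds t and an N step adds nothing, so the marks run through the classes
  -- of v, v + t, v + 2t and so on.
  marks-congruent : ∀ {a e b} v (w : Word a e b) →
    All (λ m → ∃ λ j → j ℕ.< a ℕ.+ e × proj₁ m ≋ v + + j * + t) (marks v w)
  marks-congruent v [] = []
  marks-congruent v (D∷ w) =
    (0 , s≤s z≤n , index-zero)
    ∷ All.map (λ { (j , j< , c) → suc j , s≤s j< , index-D {v = v} {j} c }) (marks-congruent _ w)
  marks-congruent {a} {suc e} v (E∷ w) rewrite ℕₚ.+-suc a e =
    (0 , s≤s z≤n , index-zero)
    ∷ All.map (λ { (j , j< , c) → suc j , s≤s j< , index-E {v = v} {j} c }) (marks-congruent _ w)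
  marks-congruent v (N∷ w) =
    All.map (λ { (j , j< , c) → j , j< , index-N {v = v} {j} c }) (marks-congruent _ w)

  marks-hit-step : ∀ {a e b} v (w : Word a e b) i → i ℕ.< a ℕ.+ e → Any (λ m → proj₁ m ≋ v + + i * + t) (marks v w)
  marks-hit-step v (D∷ w) zero _ = here index-zero
  marks-hit-step v (D∷ w) (suc i) (s≤s i<) = there (Any.map (index-D {v = v} {i}) (marks-hit-step _ w i i<))
  marks-hit-step v (E∷ w) zero _ = here index-zero
  marks-hit-step {a} {suc e} v (E∷ w) (suc i) i< =
    there (Any.map (index-E {v = v} {i}) (marks-hit-step _ w i (ℕ.s≤s⁻¹ (subst (suc i ℕ.<_) (ℕₚ.+-suc a e) i<))))
  marks-hit-step v (N∷ w) i i< = Any.map (index-N {v = v} {i}) (marks-hit-step _ w i i<)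

-- Coprimality: one mark in each residue class

module CoprimePath (s t : ℕ) .{{_ : ℕ.NonZero s}} (coprime : Coprime s t) where
  open Modulo s
  open Path s t

  ≋-* : ∀ {u v} k → u ≋ v → u * k ≋ v * k
  ≋-* {u} {v} k (congruent d) = congruent (subst (+ s ∣_) (lemma u v k) (∣m⇒∣m*n {m = u - v} k d))
    where
    lemma : ∀ u v k → (u - v) * k ≡ u * k - v * k
    lemma = solve-∀

  t-inverse : ∃ λ q → q * + t ≋ 1ℤ
  t-inverse with coprime-Bézout coprime
  ... | Bézout.+- x y eq = - + y , congruent (divides (- + x) (trans (lemma (+ y) (+ t)) (trans
          (cong -_ (trans (cong (λ z → 1ℤ + z) (sym (ℤₚ.pos-* y t))) (trans (cong +_ eq) (ℤₚ.pos-* x s)))) (lemma′ (+ x) (+ s)))))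
    where
    lemma : ∀ y t → - y * t - 1ℤ ≡ - (1ℤ + y * t)
    lemma = solve-∀
    lemma′ : ∀ x s → - (x * s) ≡ - x * s
    lemma′ = solve-∀
  ... | Bézout.-+ x y eq = + y , congruent (divides (+ x) (trans (cong (λ z → z - 1ℤ)
          (trans (sym (ℤₚ.pos-* y t)) (trans (cong +_ (sym eq)) (cong (λ z → 1ℤ + z) (ℤₚ.pos-* x s))))) (lemma (+ x * + s))))
    where
    lemma : ∀ z → 1ℤ + z - 1ℤ ≡ z
    lemma = solve-∀

  abstract
    residue : ∀ d → ∃ λ i → i ℕ.< s × + i ≋ d
    residue d = d %ℕ s , n%ℕd<d d s , %ℕ-≋ s d

  ≋-divide : ∀ {i q d} → q * + t ≋ 1ℤ → i ≋ d * q → i * + t ≋ d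
  ≋-divide {i} {q} {d} qt≋1 i≋dq = ≋-trans (≋-* (+ t) i≋dq)
    (subst (d * q * + t ≋_) (ℤₚ.*-identityˡ d) (subst (_≋ 1ℤ * d) (lemma q (+ t) d) (≋-* d qt≋1)))
    where
    lemma : ∀ q t d → q * t * d ≡ d * q * t
    lemma = solve-∀

  abstract
    multiple-index : ∀ v z → ∃ λ i → i ℕ.< s × v + + i * + t ≋ z
    multiple-index v z = solve-congruence t-inverse residue
      where
      lemma : ∀ z v → z - v + v ≡ z
      lemma = solve-∀
      ≋-plus : ∀ {x d} → d ≡ z - v → x ≋ d → v + x ≋ z
      ≋-plus {x} refl c = subst₂ _≋_ (ℤₚ.+-comm x v) (lemma z v) (≋-+ v c)
      divide : ∀ {d q} → d ≡ z - v → q * + t ≋ 1ℤ → (∃ λ i → i ℕ.< s × + i ≋ d * q) → ∃ λ i → i ℕ.< s × v + + i * + t ≋ z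
      divide d≡ qt≋1 (i , i<s , i≋) = i , i<s , ≋-plus d≡ (≋-divide qt≋1 i≋)
      solve-congruence : (∃ λ q → q * + t ≋ 1ℤ) → (∀ d → ∃ λ i → i ℕ.< s × + i ≋ d) → ∃ λ i → i ℕ.< s × v + + i * + t ≋ z
      solve-congruence (q , qt≋1) res = divide refl qt≋1 (res ((z - v) * q))

  ≋-+⇒∣ : ∀ {v d} → v + d ≋ v → + s ∣ d
  ≋-+⇒∣ {v} {d} (congruent div) = subst (+ s ∣_) (lemma v d) div
    where
    lemma : ∀ v d → v + d - v ≡ d
    lemma = solve-∀

  multiple-∣ : ∀ j → + s ∣ + j * + t → s ℕ∣.∣ j
  multiple-∣ j d = coprime-divisor coprime (subst (s ℕ∣.∣_) (ℕₚ.*-comm j t)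
    (∣⇒∣ᵤ {i = + (j ℕ.* t)} (subst (+ s ∣_) (sym (ℤₚ.pos-* j t)) d)))

  multiple-≢ : ∀ v j → suc j ℕ.< s → ¬ (v + + suc j * + t ≋ v)
  multiple-≢ v j j<s c = ℕₚ.<⇒≱ j<s (ℕ∣.∣⇒≤ (multiple-∣ (suc j) (≋-+⇒∣ c)))

  marks-hit : ∀ {a e b} v (w : Word a e b) → a ℕ.+ e ≡ s → ∀ y → Any (λ m → proj₁ m ≋ y) (marks v w)
  marks-hit v w a+e≡s y with multiple-index v y
  ... | i , i<s , c = Any.map (λ c′ → ≋-trans c′ c) (marks-hit-step v w i (subst (i ℕ.<_) (sym a+e≡s) i<s))

  Incongruent : Mark → Mark → Set
  Incongruent m m′ = ¬ (proj₁ m ≋ proj₁ m′)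

  marks-distinct : ∀ {a e b} v (w : Word a e b) → a ℕ.+ e ℕ.≤ s → AllPairs Incongruent (marks v w)
  marks-distinct v [] _ = []
  marks-distinct v (D∷ w) a+e≤s =
    All.map (λ { (j , j< , c) v≋ → multiple-≢ v j (ℕₚ.<-≤-trans (s≤s j<) a+e≤s) (≋-sym (≋-trans v≋ (index-D {v = v} {j} c))) })
            (marks-congruent _ w)
    ∷ marks-distinct _ w (ℕₚ.<⇒≤ a+e≤s)
  marks-distinct {a} {suc e} v (E∷ w) a+e≤s rewrite ℕₚ.+-suc a e =
    All.map (λ { (j , j< , c) v≋ → multiple-≢ v j (ℕₚ.<-≤-trans (s≤s j<) a+e≤s) (≋-sym (≋-trans v≋ (index-E {v = v} {j} c))) })
            (marks-congruent _ w)
    ∷ marks-distinct _ w (ℕₚ.<⇒≤ a+e≤s)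
  marks-distinct v (N∷ w) a+e≤s = marks-distinct _ w a+e≤s

  same-mark : ∀ {ms m m′} → AllPairs Incongruent ms → m ∈ ms → m′ ∈ ms → proj₁ m ≋ proj₁ m′ → m ≡ m′
  same-mark (_ ∷ _)  (here refl) (here refl) _ = refl
  same-mark (d ∷ _)  (here refl) (there q)   c = ⊥-elim (All.lookup d q c)
  same-mark (d ∷ _)  (there p)   (here refl) c = ⊥-elim (All.lookup d p (≋-sym c))
  same-mark (_ ∷ ds) (there p)   (there q)   c = same-mark ds p q c

  -- Every class contains some `f m`, so all integers below the least of these values belong to the
  -- set, and none above the greatest.
  under-charge : ∀ (f : Mark → ℤ) ms → (∀ y → Any (λ m → f m ≋ y) ms) → ∃ λ c → HasCharge c (λ y → Any (λ m → y ≼ f m) ms)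
  under-charge f ms hit with lower-bound (map f ms) | upper-bound (map f ms)
  ... | lo , lo≤ | hi , ≤hi = charge-exists _ (λ y → any? (λ m → ≼? y (f m)) ms) lo (1ℤ + hi) low high
    where
    low : ∀ y → y < lo → Any (λ m → y ≼ f m) ms
    low y y<lo = let m , m∈ , c = find (hit y) in lose m∈ (below m m∈ (compare y (f m) c))
      where
      below : ∀ m → m ∈ ms → y ≼ f m ⊎ f m + + s ≼ y → y ≼ f m
      below m m∈ (inj₁ y≼) = y≼
      below m m∈ (inj₂ le) = ⊥-elim (ℤₚ.<⇒≱ y<lo (ℤₚ.≤-trans (All.lookup (Allₚ.map⁻ lo≤) m∈)
        (ℤₚ.≤-trans (by≤ (0≤+ {s}) refl) (≼⇒≤ le))))
    high : ∀ y → 1ℤ + hi ≤ y → ¬ Any (λ m → y ≼ f m) ms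
    high y hi<y p = let m , m∈ , y≼ = find p in
      ℤₚ.<⇒≱ (ℤₚ.suc[i]≤j⇒i<j hi<y) (ℤₚ.≤-trans (≼⇒≤ y≼) (All.lookup (Allₚ.map⁻ ≤hi) m∈))

  adjacent-≋ : ∀ {u x} → Adjacent (u , x) → x ≋ u
  adjacent-≋ adj = ≋-sym (≼⇒≋ (adjacent-≼ adj))

  InY-charge : ∀ {a e b} v (w : Word a e b) → a ℕ.+ e ≡ s → ∃ λ c → HasCharge c (InY (marks v w))
  InY-charge v w eq = under-charge proj₁ (marks v w) (marks-hit v w eq)

  InX-charge : ∀ {a e b} v (w : Word a e b) → a ℕ.+ e ≡ s → ∃ λ c → HasCharge c (InX (marks v w))
  InX-charge v w eq = under-charge proj₂ (marks v w) λ y →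
    let m , m∈ , c = find (marks-hit v w eq y) in lose m∈ (≋-trans (adjacent-≋ (All.lookup (marks-adjacent v w) m∈)) c)

  ≼-acyclic : ∀ {u v w} → u ≼ v → v ≡ w - + s → w ≼ u → ⊥
  ≼-acyclic {u} {v} {w} u≼v v≡ w≼u =
    ℤₚ.<⇒≱ (by< (gap≤ (+≤+ (ℕ.>-nonZero⁻¹ s))) (lemma w (+ s))) (ℤₚ.≤-trans (≼⇒≤ w≼u) (subst (u ≤_) v≡ (≼⇒≤ u≼v)))
    where
    lemma : ∀ w s → w ≡ 1ℤ + (w - s) + (s - 1ℤ)
    lemma = solve-∀

  ∉InX-diagonal : ∀ {ms u} → AllPairs Incongruent ms → All Adjacent ms → (u , u - + s) ∈ ms → ¬ InX ms u
  ∉InX-diagonal {ms} {u} ds adj u∈ p =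
    let m , m∈ , u≼x = find p
        u≋ = ≋-trans (≋-sym (≼⇒≋ u≼x)) (adjacent-≋ (All.lookup adj m∈))
    in ≼-acyclic u≼x (cong proj₂ (sym (same-mark ds u∈ m∈ u≋))) ≼-refl

  ∉InY-above : ∀ {ms m v} → AllPairs Incongruent ms → m ∈ ms → proj₁ m ≼ v - + s → ¬ InY ms v
  ∉InY-above {ms} {m} {v} ds m∈ u≼ p =
    let m′ , m′∈ , v≼u′ = find p
        m≋ = ≋-sym (≋-trans (≼⇒≋ v≼u′) (≋-trans (≼⇒≋ (-s≼ v)) (≼⇒≋ u≼)))
    in ≼-acyclic u≼ refl (subst (v ≼_) (cong proj₁ (sym (same-mark ds m∈ m′∈ m≋))) v≼u′)

  ∈-diagonals⇒∈-marks : ∀ {a e b} v (w : Word a e b) {u} → u ∈ diagonals v w → (u , u - + s) ∈ marks v w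
  ∈-diagonals⇒∈-marks v (D∷ w) (here refl) = here refl
  ∈-diagonals⇒∈-marks v (D∷ w) (there u∈)  = there (∈-diagonals⇒∈-marks _ w u∈)
  ∈-diagonals⇒∈-marks v (E∷ w) u∈          = there (∈-diagonals⇒∈-marks _ w u∈)
  ∈-diagonals⇒∈-marks v (N∷ w) u∈          = ∈-diagonals⇒∈-marks _ w u∈

  ∈-marks⇒∈-diagonals : ∀ {a e b} v (w : Word a e b) {u x} → (u , x) ∈ marks v w → x ≡ u ⊎ u ∈ diagonals v w
  ∈-marks⇒∈-diagonals v (D∷ w) (here refl) = inj₂ (here refl)
  ∈-marks⇒∈-diagonals v (D∷ w) (there m∈)  = Sum.map₂ there (∈-marks⇒∈-diagonals _ w m∈)
  ∈-marks⇒∈-diagonals v (E∷ w) (here refl) = inj₁ refl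
  ∈-marks⇒∈-diagonals v (E∷ w) (there m∈)  = ∈-marks⇒∈-diagonals _ w m∈
  ∈-marks⇒∈-diagonals v (N∷ w) m∈          = ∈-marks⇒∈-diagonals _ w m∈

  diagonals-unique : ∀ {a e b} v (w : Word a e b) → AllPairs Incongruent (marks v w) → Unique (diagonals v w)
  diagonals-unique v []     _        = []
  diagonals-unique v (D∷ w) (d ∷ ds) =
    ∉⇒Unique∷ (λ v∈ → All.lookup d (∈-diagonals⇒∈-marks _ w v∈) ≋-refl) (diagonals-unique _ w ds)
  diagonals-unique v (E∷ w) (_ ∷ ds) = diagonals-unique _ w ds
  diagonals-unique v (N∷ w) ds       = diagonals-unique _ w ds

  -- Y has one element more than X in the class of a D mark, and the same elements in the class of
  -- an E mark.
  word-charges : ∀ {a e b c c′} v (w : Word a e b) → a ℕ.+ e ≡ s →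
                 HasCharge c (InX (marks v w)) → HasCharge c′ (InY (marks v w)) → c′ ≡ c + + a
  word-charges {a} {c = c} v w a+e≡s hX hY = trans
    (charge-diff hX hY (diagonals-unique v w distinct) (proj₁ (nested-s adj))
      (λ u u∈ → let m∈ = ∈-diagonals⇒∈-marks v w u∈ in lose m∈ ≼-refl , ∉InX-diagonal distinct adj m∈)
      (λ y p ¬q → gap y ¬q (find p)))
    (cong (λ n → c + + n) (length-diagonals v w))
    where
    adj = marks-adjacent v w
    distinct = marks-distinct v w (ℕₚ.≤-reflexive a+e≡s)
    gap : ∀ y → ¬ InX (marks v w) y → (∃ λ m → m ∈ marks v w × y ≼ proj₁ m) → y ∈ diagonals v w
    gap y ¬q (m , m∈ , zero steps u≡) with ∈-marks⇒∈-diagonals v w m∈ | trans u≡ (ℤₚ.+-identityʳ y)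
    ... | inj₁ refl | refl = ⊥-elim (¬q (lose m∈ ≼-refl))
    ... | inj₂ u∈   | refl = u∈
    -- At least one step below the top of Y, y is already at or below the top of X.
    gap y ¬q ((u , x) , m∈ , suc k steps u≡) = ⊥-elim (¬q (lose m∈ (≼-trans (k steps trans (cong (λ z → z - + s) u≡) (lemma y (+ k) (+ s)))
                                              (adjacent-s≼ (All.lookup (marks-adjacent v w) m∈)))))
      where
      lemma : ∀ y k s → y + (1ℤ + k) * s - s ≡ y + k * s
      lemma = solve-∀

  Follows : ∀ {a e b} → (X Y : ℤ → Set) → ℤ → Word a e b → Set
  Follows X Y v []     = ⊤
  Follows X Y v (D∷ w) = (Y v × ¬ X v) × Follows X Y (v + + t - + s) w
  Follows X Y v (E∷ w) = X v × Follows X Y (v + + t) w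
  Follows X Y v (N∷ w) = ¬ Y v × Follows X Y (v - + s) w

  -- Since X lies in Y, the conditions for the three letters exclude one another, so each vertex
  -- dictates the next step.
  follows-unique : ∀ {a e b X Y v} → X ⊆′ Y → (w w′ : Word a e b) → Follows X Y v w → Follows X Y v w′ → w ≡ w′
  follows-unique X⊆Y []     []      _       _       = refl
  follows-unique X⊆Y (D∷ w) (D∷ w′) (_ , f) (_ , g) = cong D∷_ (follows-unique X⊆Y w w′ f g)
  follows-unique X⊆Y (E∷ w) (E∷ w′) (_ , f) (_ , g) = cong E∷_ (follows-unique X⊆Y w w′ f g)
  follows-unique X⊆Y (N∷ w) (N∷ w′) (_ , f) (_ , g) = cong N∷_ (follows-unique X⊆Y w w′ f g)
  follows-unique X⊆Y (D∷ w) (E∷ w′) ((_ , ¬x) , _) (x , _)  = ⊥-elim (¬x x)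
  follows-unique X⊆Y (D∷ w) (N∷ w′) ((y , _) , _)  (¬y , _) = ⊥-elim (¬y y)
  follows-unique X⊆Y (E∷ w) (D∷ w′) (x , _) ((_ , ¬x) , _)  = ⊥-elim (¬x x)
  follows-unique X⊆Y (E∷ w) (N∷ w′) (x , _) (¬y , _)        = ⊥-elim (¬y (X⊆Y _ x))
  follows-unique X⊆Y (N∷ w) (D∷ w′) (¬y , _) ((y , _) , _)  = ⊥-elim (¬y y)
  follows-unique X⊆Y (N∷ w) (E∷ w′) (¬y , _) (x , _)        = ⊥-elim (¬y (X⊆Y _ x))

  follows-cong : ∀ {a e b X Y X′ Y′ v} → X ≐′ X′ → Y ≐′ Y′ → (w : Word a e b) → Follows X Y v w → Follows X′ Y′ v w
  follows-cong eX eY []     _ = tt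
  follows-cong eX eY (D∷ w) ((y , ¬x) , f) = (proj₁ eY _ y , λ x → ¬x (proj₂ eX _ x)) , follows-cong eX eY w f
  follows-cong eX eY (E∷ w) (x , f)  = proj₁ eX _ x , follows-cong eX eY w f
  follows-cong eX eY (N∷ w) (¬y , f) = (λ y → ¬y (proj₂ eY _ y)) , follows-cong eX eY w f

  next-mark : ∀ {a e b} v (w : Word a e b) → (∃ λ m → m ∈ marks v w × proj₁ m ≼ v) ⊎ end v w ≼ v
  next-mark v []     = inj₂ ≼-refl
  next-mark v (D∷ w) = inj₁ (_ , here refl , ≼-refl)
  next-mark v (E∷ w) = inj₁ (_ , here refl , ≼-refl)
  next-mark v (N∷ w) = Sum.map (λ { (m , m∈ , le) → m , m∈ , ≼-trans le (-s≼ v) }) (λ le → ≼-trans le (-s≼ v)) (next-mark _ w)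

  -- The N steps are the delicate ones. After an N step at v the walk descends within the class of v
  -- until it meets a mark or ends, so the top of Y in that class is at most v - s and v is outside
  -- Y. The hypothesis that the end is a top covers a final run of N steps.
  word-follows : ∀ {a e b} ms → AllPairs Incongruent ms → All Adjacent ms → ∀ v (w : Word a e b) →
                 (∀ {m} → m ∈ marks v w → m ∈ ms) → (∃ λ m → m ∈ ms × proj₁ m ≡ end v w) →
                 Follows (InX ms) (InY ms) v w
  word-follows ms ds adj v []     sub last = tt
  word-follows ms ds adj v (D∷ w) sub last =
    (lose (sub (here refl)) ≼-refl , ∉InX-diagonal ds adj (sub (here refl))) , word-follows ms ds adj _ w (λ m∈ → sub (there m∈)) last
  word-follows ms ds adj v (E∷ w) sub last =
    lose (sub (here refl)) ≼-refl , word-follows ms ds adj _ w (λ m∈ → sub (there m∈)) last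
  word-follows ms ds adj v (N∷ w) sub last = outside (next-mark (v - + s) w) , word-follows ms ds adj _ w sub last
    where
    outside : (∃ λ m → m ∈ marks (v - + s) w × proj₁ m ≼ v - + s) ⊎ end (v - + s) w ≼ v - + s → ¬ InY ms v
    outside (inj₁ (m , m∈ , le)) = ∉InY-above ds (sub m∈) le
    outside (inj₂ le) = let m , m∈ , eq = last in ∉InY-above ds m∈ (subst (_≼ v - + s) (sym eq) le)

nested-cong : ∀ {s X Y X′ Y′} → X ≐′ X′ → Y ≐′ Y′ → Nested s X Y → Nested s X′ Y′
nested-cong (f , f⁻) (g , g⁻) (X⊆Y , Y-s⊆X) = (λ x p → g x (X⊆Y x (f⁻ x p))) , (λ y p → f _ (Y-s⊆X y (g⁻ y p)))

≐-sym : ∀ {P Q : ℤ → Set} → P ≐′ Q → Q ≐′ P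
≐-sym (f , g) = g , f

≐-trans : ∀ {P Q R : ℤ → Set} → P ≐′ Q → Q ≐′ R → P ≐′ R
≐-trans (f , g) (h , k) = (λ x p → h x (f x p)) , (λ x p → g x (k x p))

Start : ∀ {a e b} → Word a e b → Set
Start []     = ⊥
Start (D∷ _) = ⊤
Start (E∷ _) = ⊤
Start (N∷ _) = ⊥

-- Nested pairs and closed words

module Correspondence (s t : ℕ) .{{_ : ℕ.NonZero s}} (coprime : Coprime s t) where
  open Modulo s
  open Path s t
  open CoprimePath s t coprime

  module _ {X Y : ℤ → Set} (ns : Nested s X Y) (nt : Nested t X Y) where

    private
      X⊆Y = proj₁ ns
      Y-s⊆X = proj₂ ns
      Y-t⊆X = proj₂ nt

      closedX : Closed X
      closedX x p = Y-s⊆X x (X⊆Y x p)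
      closedY : Closed Y
      closedY y p = X⊆Y _ (Y-s⊆X y p)

      after-D : ∀ v → ¬ X v → ¬ Y (v + + t - + s + + s)
      after-D v ¬x y = ¬x (subst X (lemma v (+ t) (+ s)) (Y-t⊆X _ y))
        where
        lemma : ∀ v t s → v + t - s + s - t ≡ v
        lemma = solve-∀
      after-E : ∀ v → ¬ Y (v + + s) → ¬ Y (v + + t + + s)
      after-E v ¬y y = ¬y (X⊆Y _ (subst X (lemma v (+ t) (+ s)) (Y-t⊆X _ y)))
        where
        lemma : ∀ v t s → v + t + s - t ≡ v + s
        lemma = solve-∀
      cancel-s : ∀ {P : ℤ → Set} v → ¬ P v → ¬ P (v - + s + + s)
      cancel-s {P} v ¬p p = ¬p (subst P (lemma v (+ s)) p)
        where
        lemma : ∀ v s → v - s + s ≡ v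
        lemma = solve-∀

    MarkTops : Mark → Set
    MarkTops (u , x) = Top Y u × Top X x

    -- The invariant is that v + s is outside Y, so that every vertex in Y is the top of its class.
    -- Nestedness for t preserves it along E and D steps; after an N step it says that the vertex
    -- just left was outside Y.
    follows-tops : ∀ {a e b} v (w : Word a e b) → ¬ Y (v + + s) → Follows X Y v w →
                   All MarkTops (marks v w) × ¬ Y (end v w + + s)
    follows-tops v []     ¬y _ = [] , ¬y
    follows-tops v (D∷ w) ¬y ((y , ¬x) , f) =
      let tops , last = follows-tops _ w (after-D v ¬x) f
      in ((y , ¬y) , (Y-s⊆X v y , cancel-s {X} v ¬x)) ∷ tops , last
    follows-tops v (E∷ w) ¬y (x , f) =
      let tops , last = follows-tops _ w (after-E v ¬y) f
      in ((X⊆Y v x , ¬y) , (x , λ x+ → ¬y (X⊆Y _ x+))) ∷ tops , last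
    follows-tops v (N∷ w) ¬y (¬yv , f) = follows-tops _ w (cancel-s {Y} v ¬yv) f

    follows⇒marks : ∀ {a e b} v (w : Word a e b) → a ℕ.+ e ≡ s → ¬ Y (v + + s) → Follows X Y v w →
                    X ≐′ InX (marks v w) × Y ≐′ InY (marks v w)
    follows⇒marks v w a+e≡s ¬y f = (X⊆InX , InX⊆X) , (Y⊆InY , InY⊆Y)
      where
      tops : All MarkTops (marks v w)
      tops = proj₁ (follows-tops v w ¬y f)
      X⊆InX : X ⊆′ InX (marks v w)
      X⊆InX x p = let m , m∈ , c = find (marks-hit v w a+e≡s x) in
        lose m∈ (top-≼ closedX (proj₂ (All.lookup tops m∈)) (≋-trans (adjacent-≋ (All.lookup (marks-adjacent v w) m∈)) c) p)
      InX⊆X : InX (marks v w) ⊆′ X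
      InX⊆X x p = let m , m∈ , le = find p in closed-≼ closedX le (proj₁ (proj₂ (All.lookup tops m∈)))
      Y⊆InY : Y ⊆′ InY (marks v w)
      Y⊆InY y p = let m , m∈ , c = find (marks-hit v w a+e≡s y) in lose m∈ (top-≼ closedY (proj₁ (All.lookup tops m∈)) c p)
      InY⊆Y : InY (marks v w) ⊆′ Y
      InY⊆Y y p = let m , m∈ , le = find p in closed-≼ closedY le (proj₁ (proj₁ (All.lookup tops m∈)))

    module _ (X? : ∀ x → Dec (X x)) (Y? : ∀ y → Dec (Y y)) (Y-low : ∀ v → ∃ λ k → Y (v - + k * + s)) where

      -- Here n counts the E and D steps still to come, and k bounds the current run of N steps. At
      -- n = 0 the walk still descends until it is in Y, so that it can end at a top.
      follow : ∀ n k v → Y (v - + k * + s) →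
               ∃ λ a → ∃ λ e → ∃ λ b → ∃ λ (w : Word a e b) → a ℕ.+ e ≡ n × Follows X Y v w × Y (end v w)
      follow n k v low with Y? v
      follow n zero    v low | no ¬y = ⊥-elim (¬y (subst Y (lemma v) low))
        where
        lemma : ∀ v → v - 0ℤ ≡ v
        lemma = solve-∀
      follow n (suc k) v low | no ¬y =
        let a , e , b , w , eq , f , l = follow n k (v - + s) (subst Y (lemma v (+ k) (+ s)) low)
        in a , e , suc b , (N∷ w) , eq , (¬y , f) , l
        where
        lemma : ∀ v k s → v - (1ℤ + k) * s ≡ v - s - k * s
        lemma = solve-∀
      follow zero    k v low | yes y = 0 , 0 , 0 , [] , refl , tt , y
      follow (suc n) k v low | yes y with X? v
      ... | yes x = let k′ , low′ = Y-low (v + + t)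
                        a , e , b , w , eq , f , l = follow n k′ (v + + t) low′
                    in a , suc e , b , (E∷ w) , trans (ℕₚ.+-suc a e) (cong suc eq) , (x , f) , l
      ... | no ¬x = let k′ , low′ = Y-low (v + + t - + s)
                        a , e , b , w , eq , f , l = follow n k′ (v + + t - + s) low′
                    in suc a , e , b , (D∷ w) , cong suc eq , ((y , ¬x) , f) , l

      -- After s marks the end is congruent to p, lies in Y and satisfies the invariant of
      -- `follows-tops`; it is thus the top of the class of p, which is p. The total displacement s
      -- t - (a + b) s then vanishes, whence a + b = t.
      closed-path : ∀ p → Top Y p →
        ∃ λ a → ∃ λ e → ∃ λ b → ∃ λ (w : Word a e b) → a ℕ.+ e ≡ s × a ℕ.+ b ≡ t × Follows X Y p w
      closed-path p top@(y , ¬y) with follow s 0 p (subst Y (lemma p) y)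
        where
        lemma : ∀ p → p ≡ p - 0ℤ
        lemma = solve-∀
      ... | a , e , b , w , refl , f , l = a , e , b , w , refl , a+b≡t , f
        where
        end≡ : end p w ≡ p + (+ a + + e) * + t - (+ a + + b) * + s
        end≡ = end-formula p w
        end≋p : end p w ≋ p
        end≋p = subst (_≋ p) (trans (lemma p (+ t) (+ a) (+ e) (+ b)) (sym end≡)) (+k*s≋ p (+ t - (+ a + + b)))
          where
          lemma : ∀ p t a e b → p + (t - (a + b)) * (a + e) ≡ p + (a + e) * t - (a + b) * (a + e)
          lemma = solve-∀
        end≡p : end p w ≡ p
        end≡p = top-unique closedY (l , proj₂ (follows-tops p w ¬y f)) top end≋p
        a+b≡t : a ℕ.+ b ≡ t
        a+b≡t = ℤₚ.+-injective (ℤₚ.*-cancelʳ-≡ (+ (a ℕ.+ b)) (+ t) (+ (a ℕ.+ e))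
          (balance p (+ a + + e) (+ t) (+ a + + b) (trans (sym end≡p) end≡)))
          where
          lemma : ∀ p m t n → n * m ≡ t * m - (p + m * t - n * m - p)
          lemma = solve-∀
          lemma′ : ∀ m t p → t * m - (p - p) ≡ t * m
          lemma′ = solve-∀
          balance : ∀ p m t n → p ≡ p + m * t - n * m → n * m ≡ t * m
          balance p m t n eq = trans (lemma p m t n) (trans (cong (λ z → t * m - (z - p)) (sym eq)) (lemma′ m t p))

  marks-shift : ∀ {a e b} k v (w : Word a e b) → marks (v + k) w ≡ map (λ m → proj₁ m + k , proj₂ m + k) (marks v w)
  marks-shift k v [] = refl
  marks-shift k v (D∷ w) = cong₂ _∷_ (cong (v + k ,_) (lemma v k (+ s)))
    (trans (cong (λ z → marks z w) (lemma′ v k (+ t) (+ s))) (marks-shift k _ w))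
    where
    lemma : ∀ v k s → v + k - s ≡ v - s + k
    lemma = solve-∀
    lemma′ : ∀ v k t s → v + k + t - s ≡ v + t - s + k
    lemma′ = solve-∀
  marks-shift k v (E∷ w) = cong (_ ∷_) (trans (cong (λ z → marks z w) (lemma v k (+ t))) (marks-shift k _ w))
    where
    lemma : ∀ v k t → v + k + t ≡ v + t + k
    lemma = solve-∀
  marks-shift k v (N∷ w) = trans (cong (λ z → marks z w) (lemma v k (+ s))) (marks-shift k _ w)
    where
    lemma : ∀ v k s → v + k - s ≡ v - s + k
    lemma = solve-∀

  InX-shift : ∀ {a e b} k v (w : Word a e b) → InX (marks (v + k) w) ≐′ λ x → InX (marks v w) (x - k)
  InX-shift k v w = to , from
    where
    lemma : ∀ y k → y + k - k ≡ y
    lemma = solve-∀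
    lemma′ : ∀ x k → x - k + k ≡ x
    lemma′ = solve-∀
    to : InX (marks (v + k) w) ⊆′ λ x → InX (marks v w) (x - k)
    to x p = Any.map (λ {m} le → subst (x - k ≼_) (lemma (proj₂ m) k) (≼-minus k le))
      (Anyₚ.map⁻ (subst (λ ms → InX ms x) (marks-shift k v w) p))
    from : (λ x → InX (marks v w) (x - k)) ⊆′ InX (marks (v + k) w)
    from x p = subst (λ ms → InX ms x) (sym (marks-shift k v w))
      (Anyₚ.map⁺ (Any.map (λ {m} le → subst (_≼ proj₂ m + k) (lemma′ x k) (≼-plus k le)) p))

  closed-end : ∀ {a e b} p (w : Word a e b) → a ℕ.+ e ≡ s → a ℕ.+ b ≡ t → end p w ≡ p
  closed-end {a} {e} {b} p w refl refl = trans (end-formula p w) (lemma p (+ a + + e) (+ a + + b))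
    where
    lemma : ∀ p m n → p + m * n - n * m ≡ p
    lemma = solve-∀

  start-∈ : ∀ {a e b} p (w : Word a e b) → Start w → ∃ λ m → m ∈ marks p w × proj₁ m ≡ p
  start-∈ p (D∷ w) _ = _ , here refl , refl
  start-∈ p (E∷ w) _ = _ , here refl , refl

  Describes : ∀ {a e b} → ℤ → Bipartition → Word a e b → ℤ → Set
  Describes c (l , m) w p = Bead 0ℤ l ≐′ InX (marks p w) × Bead c m ≐′ InY (marks p w)

  describes-follows : ∀ {a e b c B} p (w : Word a e b) → a ℕ.+ e ≡ s → a ℕ.+ b ≡ t → Start w → Describes c B w p →
                      Follows (Bead 0ℤ (proj₁ B)) (Bead c (proj₂ B)) p w
  describes-follows p w a+e≡s a+b≡t st (eX , eY) = follows-cong (≐-sym eX) (≐-sym eY) w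
    (word-follows (marks p w) (marks-distinct p w (ℕₚ.≤-reflexive a+e≡s)) (marks-adjacent p w) p w (λ m∈ → m∈)
      (let m , m∈ , eq = start-∈ p w st in m , m∈ , trans eq (sym (closed-end p w a+e≡s a+b≡t))))

  describes-top : ∀ {a e b c B} p (w : Word a e b) → a ℕ.+ e ≡ s → Start w → Describes c B w p → Top (Bead c (proj₂ B)) p
  describes-top p w a+e≡s st (eX , eY) = let m , m∈ , eq = start-∈ p w st in
    proj₂ eY p (lose m∈ (subst (p ≼_) (sym eq) ≼-refl)) ,
    λ y → ∉InY-above (marks-distinct p w (ℕₚ.≤-reflexive a+e≡s)) m∈
            (subst₂ _≼_ (sym eq) (lemma p (+ s)) ≼-refl) (proj₁ eY _ y)
    where
    lemma : ∀ p s → p ≡ p + s - s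
    lemma = solve-∀

  describes-nested : ∀ {a e b c B} p (w : Word a e b) → a ℕ.+ e ≡ s → a ℕ.+ b ≡ t → Describes c B w p →
    Nested s (Bead 0ℤ (proj₁ B)) (Bead c (proj₂ B)) × Nested t (Bead 0ℤ (proj₁ B)) (Bead c (proj₂ B))
  describes-nested p w a+e≡s a+b≡t (eX , eY) =
    nested-cong (≐-sym eX) (≐-sym eY) (nested-s (marks-adjacent p w)) ,
    nested-cong (≐-sym eX) (≐-sym eY) (nested-t p w (λ eq → ℕ.≢-nonZero⁻¹ s (trans (sym a+e≡s) eq)) (closed-end p w a+e≡s a+b≡t))

  abstract
    -- Started at 0, the walk gives X some charge c; started at - c, it gives X the charge 0, and Y
    -- the charge a by `word-charges`.
    word⇒bipartition : ∀ {a e b} (w : Word a e b) → a ℕ.+ e ≡ s → ∃ λ B → IsBipartition B × ∃ (Describes (+ a) B w)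
    word⇒bipartition {a} w a+e≡s =
      let c , hX = InX-charge 0ℤ w a+e≡s
          l , il , eX = shifted hX
          c′ , hY = InY-charge (0ℤ - c) w a+e≡s
          m , im , eY = subst (λ c′ → HasCharge c′ (InY (marks (0ℤ - c) w)))
                          (trans (word-charges {c = 0ℤ} (0ℤ - c) w a+e≡s (l , il , eX) hY) (ℤₚ.+-identityˡ (+ a))) hY
      in (l , m) , (il , im) , (0ℤ - c) , ≐-sym eX , ≐-sym eY
      where
      shifted : ∀ {c} → HasCharge c (InX (marks 0ℤ w)) → HasCharge 0ℤ (InX (marks (0ℤ - c) w))
      shifted {c} hX = subst (λ d → HasCharge d (InX (marks (0ℤ - c) w))) (ℤₚ.+-inverseʳ c) (charge-cong (InX-shift (- c) 0ℤ w) (charge-shift (- c) hX))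

  -- Moving the start from p to p′ raises the charge of X by p′ - p. As this charge is 0 in both
  -- cases, the starts coincide.
  describes-unique : ∀ {a e b c B B′ p p′} (w : Word a e b) → IsBipartition B → IsBipartition B′ →
                     Describes c B w p → Describes c B′ w p′ → p ≡ p′ × B ≡ B′
  describes-unique {c = c} {B} {B′} {p} {p′} w (il , im) (il′ , im′) (eX , eY) (eX′ , eY′) = p≡p′ , same p≡p′ eX′ eY′
    where
    lemma : ∀ p p′ → p + (p′ - p) ≡ p′
    lemma = solve-∀
    lemma′ : ∀ p → p + 0ℤ ≡ p
    lemma′ = solve-∀
    hX : HasCharge (0ℤ + (p′ - p)) (InX (marks p′ w))
    hX = charge-cong (subst (λ q → InX (marks q w) ≐′ λ x → InX (marks p w) (x - (p′ - p))) (lemma p p′) (InX-shift (p′ - p) p w))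
           (charge-shift (p′ - p) (proj₁ B , il , ≐-sym eX))
    p≡p′ : p ≡ p′
    p≡p′ = trans (sym (lemma′ p)) (trans (cong (λ z → p + z)
      (trans (charge-unique hX (proj₁ B′ , il′ , ≐-sym eX′)) (ℤₚ.+-identityˡ _))) (lemma p p′))
    same : p ≡ p′ → Bead 0ℤ (proj₁ B′) ≐′ InX (marks p′ w) → Bead c (proj₂ B′) ≐′ InY (marks p′ w) → B ≡ B′
    same refl eX′ eY′ = cong₂ _,_ (bead-injective 0ℤ il il′ (≐-trans eX (≐-sym eX′)))
                                  (bead-injective c im im′ (≐-trans eY (≐-sym eY′)))

  -- Both starts are tops of Y in one class, hence equal, and both words obey the same rule from
  -- there.
  describes-same-word : ∀ {a e b c B p p′} (w w′ : Word a e b) → a ℕ.+ e ≡ s → a ℕ.+ b ≡ t → Start w → Start w′ →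
                        p ≋ p′ → Describes c B w p → Describes c B w′ p′ → w ≡ w′
  describes-same-word {c = c} {B} {p} {p′} w w′ a+e≡s a+b≡t st st′ p≋p′ d d′ =
    follows-unique (proj₁ nested) w w′ (describes-follows p w a+e≡s a+b≡t st d)
      (subst (λ q → Follows (Bead 0ℤ (proj₁ B)) (Bead c (proj₂ B)) q w′) (sym p≡p′) (describes-follows p′ w′ a+e≡s a+b≡t st′ d′))
    where
    nested : Nested s (Bead 0ℤ (proj₁ B)) (Bead c (proj₂ B))
    nested = proj₁ (describes-nested p w a+e≡s a+b≡t d)
    p≡p′ : p ≡ p′
    p≡p′ = top-unique (λ y q → proj₁ nested _ (proj₂ nested y q)) (describes-top p w a+e≡s st d) (describes-top p′ w′ a+e≡s st′ d′) p≋p′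

  abstract
    bipartition⇒word : ∀ {c B} → IsBipartition B →
      Nested s (Bead 0ℤ (proj₁ B)) (Bead (+ c) (proj₂ B)) → Nested t (Bead 0ℤ (proj₁ B)) (Bead (+ c) (proj₂ B)) →
      ∀ r → ∃ λ e → ∃ λ b → c ℕ.+ e ≡ s × c ℕ.+ b ≡ t × ∃ λ (w : Word c e b) → Start w × ∃ λ p → p ≋ r × Describes (+ c) B w p
    bipartition⇒word {c} {l , m} (il , im) ns nt r =
      let p , p≋r , top = top-exists hY r
          a , e , b , w , a+e≡s , a+b≡t , f = closed-path ns nt (bead? 0ℤ l) (bead? (+ c) m) low p top
          eX , eY = follows⇒marks ns nt p w a+e≡s (proj₂ top) f
      -- The walk yields some number of D steps; it equals c because both are the difference of the
      -- charges.
      in finish p≋r (proj₁ top) w a+e≡s a+b≡t f eX eY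
           (ℤₚ.+-injective (trans (word-charges p w a+e≡s (l , il , ≐-sym eX) (m , im , ≐-sym eY)) (ℤₚ.+-identityˡ _)))
      where
      hY : HasCharge (+ c) (Bead (+ c) m)
      hY = bead-charge im
      low : ∀ v → ∃ λ k → Bead (+ c) m (v - + k * + s)
      low v = let k , le = archimedean (1ℤ + v - (+ c - + length m)) in
        k , bead-low (+ c) m (by< (gap≤ le) (lemma v (+ c - + length m) (+ k * + s)))
        where
        lemma : ∀ v b d → b ≡ 1ℤ + (v - d) + (d - (1ℤ + v - b))
        lemma = solve-∀
      start : ∀ {a e b p} (w : Word a e b) → Bead (+ c) m p → a ℕ.+ e ≡ s → Follows (Bead 0ℤ l) (Bead (+ c) m) p w → Start w
      start []     _ eq _        = ℕ.≢-nonZero⁻¹ s (sym eq)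
      start (D∷ _) _ _  _        = tt
      start (E∷ _) _ _  _        = tt
      start (N∷ _) y _  (¬y , _) = ¬y y
      finish : ∀ {a e b p} → p ≋ r → Bead (+ c) m p → (w : Word a e b) → a ℕ.+ e ≡ s → a ℕ.+ b ≡ t →
               Follows (Bead 0ℤ l) (Bead (+ c) m) p w →
               Bead 0ℤ l ≐′ InX (marks p w) → Bead (+ c) m ≐′ InY (marks p w) → c ≡ a →
               ∃ λ e → ∃ λ b → c ℕ.+ e ≡ s × c ℕ.+ b ≡ t × ∃ λ (w : Word c e b) → Start w × ∃ λ p → p ≋ r × Describes (+ c) (l , m) w p
      finish p≋r y w a+e≡s a+b≡t f eX eY refl = _ , _ , a+e≡s , a+b≡t , w , start w y a+e≡s f , _ , p≋r , eX , eY

-- Counting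

mutual
  words wordsD wordsE wordsN : ∀ a e b → List (Word a e b)
  words a e b = emptyWord a e b ++ (wordsD a e b ++ wordsE a e b) ++ wordsN a e b

  wordsD zero    e b = []
  wordsD (suc a) e b = map D∷_ (words a e b)

  wordsE a zero    b = []
  wordsE a (suc e) b = map E∷_ (words a e b)

  wordsN a e zero    = []
  wordsN a e (suc b) = map N∷_ (words a e b)

  emptyWord : ∀ a e b → List (Word a e b)
  emptyWord zero zero zero = [] ∷ []
  emptyWord _    _    _    = []

startWords : ∀ a e b → List (Word a e b)
startWords a e b = wordsD a e b ++ wordsE a e b

startWords-start : ∀ a e b {w} → w ∈ startWords a e b → Start w
startWords-start a e b w∈ with ∈-++⁻ (wordsD a e b) w∈
startWords-start (suc a) e b _ | inj₁ w∈ with _ , _ , refl ← ∈-map⁻ D∷_ w∈ = tt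
startWords-start a (suc e) b _ | inj₂ w∈ with _ , _ , refl ← ∈-map⁻ E∷_ w∈ = tt

∈-startWords⇒∈-words : ∀ {a e b} {w : Word a e b} → w ∈ startWords a e b → w ∈ words a e b
∈-startWords⇒∈-words {a} {e} {b} w∈ = ∈-++⁺ʳ (emptyWord a e b) (∈-++⁺ˡ w∈)

mutual
  ∈-words : ∀ {a e b} (w : Word a e b) → w ∈ words a e b
  ∈-words []         = here refl
  ∈-words w@(D∷ _)   = ∈-startWords⇒∈-words (∈-startWords w tt)
  ∈-words w@(E∷ _)   = ∈-startWords⇒∈-words (∈-startWords w tt)
  ∈-words {a} {e} {suc b} (N∷ w) = ∈-++⁺ʳ (emptyWord a e (suc b)) (∈-++⁺ʳ (startWords a e (suc b)) (∈-map⁺ N∷_ (∈-words w)))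

  ∈-startWords : ∀ {a e b} (w : Word a e b) → Start w → w ∈ startWords a e b
  ∈-startWords (D∷ w) _ = ∈-++⁺ˡ (∈-map⁺ D∷_ (∈-words w))
  ∈-startWords {a} {suc e} {b} (E∷ w) _ = ∈-++⁺ʳ (wordsD a (suc e) b) (∈-map⁺ E∷_ (∈-words w))

E∉wordsD : ∀ a {e b} {w : Word a e b} → (E∷ w) ∉ wordsD a (suc e) b
E∉wordsD (suc a) w∈ with ∈-map⁻ D∷_ w∈
... | _ , _ , ()

¬start-emptyWord : ∀ a e b {w} → w ∈ emptyWord a e b → ¬ Start w
¬start-emptyWord zero zero zero (here refl) ()
¬start-emptyWord zero zero (suc _) ()
¬start-emptyWord zero (suc _) _ ()
¬start-emptyWord (suc _) _ _ ()

∉wordsN-start : ∀ a e b {w} → w ∈ wordsN a e b → ¬ Start w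
∉wordsN-start a e (suc b) w∈ st with ∈-map⁻ N∷_ w∈
... | _ , _ , refl = st

∉wordsN-emptyWord : ∀ a e b {w} → w ∈ emptyWord a e b → w ∉ wordsN a e b
∉wordsN-emptyWord zero zero zero _ ()
∉wordsN-emptyWord zero zero (suc _) ()
∉wordsN-emptyWord zero (suc _) _ ()
∉wordsN-emptyWord (suc _) _ _ ()

mutual
  words-unique : ∀ a e b → Unique (words a e b)
  words-unique a e b = Uniqueₚ.++⁺ (emptyWord-unique a e b)
    (Uniqueₚ.++⁺ (startWords-unique a e b) (wordsN-unique a e b)
      λ (p , q) → ∉wordsN-start a e b q (startWords-start a e b p))
    λ (p , q) → Sum.[ (λ q → ¬start-emptyWord a e b p (startWords-start a e b q)) , ∉wordsN-emptyWord a e b p ]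
                  (∈-++⁻ (startWords a e b) q)

  startWords-unique : ∀ a e b → Unique (startWords a e b)
  startWords-unique a e b = Uniqueₚ.++⁺ (wordsD-unique a e b) (wordsE-unique a e b) (λ (p , q) → disjoint a e b p q)
    where
    disjoint : ∀ a e b {w} → w ∈ wordsD a e b → w ∉ wordsE a e b
    disjoint a (suc e) b p q with ∈-map⁻ E∷_ q
    ... | _ , _ , refl = E∉wordsD a p

  wordsD-unique : ∀ a e b → Unique (wordsD a e b)
  wordsD-unique zero    e b = []
  wordsD-unique (suc a) e b = Uniqueₚ.map⁺ (λ { refl → refl }) (words-unique a e b)

  wordsE-unique : ∀ a e b → Unique (wordsE a e b)
  wordsE-unique a zero    b = []
  wordsE-unique a (suc e) b = Uniqueₚ.map⁺ (λ { refl → refl }) (words-unique a e b)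

  wordsN-unique : ∀ a e b → Unique (wordsN a e b)
  wordsN-unique a e zero    = []
  wordsN-unique a e (suc b) = Uniqueₚ.map⁺ (λ { refl → refl }) (words-unique a e b)

  emptyWord-unique : ∀ a e b → Unique (emptyWord a e b)
  emptyWord-unique zero zero zero          = [] ∷ []
  emptyWord-unique zero zero (suc _)       = []
  emptyWord-unique zero (suc _) _          = []
  emptyWord-unique (suc _) _ _             = []

weight : ℕ → ℕ → ℕ → ℕ
weight a e b = a ! ℕ.* e ! ℕ.* b !

mutual
  -- The multinomial coefficient with its denominator cleared. The words whose first letter occurs k
  -- times contribute k (a + e + b - 1)!, and the three multiplicities add up to a + e + b.
  length-words : ∀ a e b → length (words a e b) ℕ.* weight a e b ≡ (a ℕ.+ e ℕ.+ b) !
  length-words zero    zero    zero    = refl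
  length-words zero    zero    (suc b) = length-words-nonempty zero zero (suc b) b refl refl
  length-words zero    (suc e) b       = length-words-nonempty zero (suc e) b (e ℕ.+ b) refl refl
  length-words (suc a) e       b       = length-words-nonempty (suc a) e b (a ℕ.+ e ℕ.+ b) refl refl

  length-words-nonempty : ∀ a e b n → emptyWord a e b ≡ [] → a ℕ.+ e ℕ.+ b ≡ suc n →
                          length (words a e b) ℕ.* weight a e b ≡ (a ℕ.+ e ℕ.+ b) !
  length-words-nonempty a e b n empty≡ sum≡ = begin
    length (words a e b) ℕ.* W
      ≡⟨ cong (λ ws → length (ws ++ startWords a e b ++ wordsN a e b) ℕ.* W) empty≡ ⟩
    length (startWords a e b ++ wordsN a e b) ℕ.* W
      ≡⟨ cong (ℕ._* W) (Listₚ.length-++ (startWords a e b)) ⟩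
    (length (startWords a e b) ℕ.+ length (wordsN a e b)) ℕ.* W
      ≡⟨ ℕₚ.*-distribʳ-+ W (length (startWords a e b)) _ ⟩
    length (startWords a e b) ℕ.* W ℕ.+ length (wordsN a e b) ℕ.* W
      ≡⟨ cong₂ ℕ._+_ (length-startWords a e b) (length-wordsN a e b) ⟩
    (a ℕ.+ e) ℕ.* (a ℕ.+ e ℕ.+ b ∸ 1) ! ℕ.+ b ℕ.* (a ℕ.+ e ℕ.+ b ∸ 1) !
      ≡⟨ ℕₚ.*-distribʳ-+ ((a ℕ.+ e ℕ.+ b ∸ 1) !) (a ℕ.+ e) b ⟨
    (a ℕ.+ e ℕ.+ b) ℕ.* (a ℕ.+ e ℕ.+ b ∸ 1) !
      ≡⟨ cong (λ k → k ℕ.* (k ∸ 1) !) sum≡ ⟩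
    suc n !
      ≡⟨ cong _! (sym sum≡) ⟩
    (a ℕ.+ e ℕ.+ b) ! ∎
    where
    open ≡-Reasoning
    W = weight a e b

  -- Leaving out the words that begin with N leaves the factor a + e = s, which later cancels
  -- against the s possible starting classes.
  length-startWords : ∀ a e b → length (startWords a e b) ℕ.* weight a e b ≡ (a ℕ.+ e) ℕ.* (a ℕ.+ e ℕ.+ b ∸ 1) !
  length-startWords a e b = begin
    length (startWords a e b) ℕ.* W ≡⟨ cong (ℕ._* W) (Listₚ.length-++ (wordsD a e b)) ⟩
    (length (wordsD a e b) ℕ.+ length (wordsE a e b)) ℕ.* W ≡⟨ ℕₚ.*-distribʳ-+ W (length (wordsD a e b)) _ ⟩
    length (wordsD a e b) ℕ.* W ℕ.+ length (wordsE a e b) ℕ.* W ≡⟨ cong₂ ℕ._+_ (length-wordsD a e b) (length-wordsE a e b) ⟩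
    a ℕ.* (a ℕ.+ e ℕ.+ b ∸ 1) ! ℕ.+ e ℕ.* (a ℕ.+ e ℕ.+ b ∸ 1) ! ≡⟨ ℕₚ.*-distribʳ-+ ((a ℕ.+ e ℕ.+ b ∸ 1) !) a e ⟨
    (a ℕ.+ e) ℕ.* (a ℕ.+ e ℕ.+ b ∸ 1) ! ∎
    where
    open ≡-Reasoning
    W = weight a e b

  length-wordsD : ∀ a e b → length (wordsD a e b) ℕ.* weight a e b ≡ a ℕ.* (a ℕ.+ e ℕ.+ b ∸ 1) !
  length-wordsD zero    e b = refl
  length-wordsD (suc a) e b = begin
    length (map D∷_ (words a e b)) ℕ.* weight (suc a) e b ≡⟨ cong (ℕ._* weight (suc a) e b) (Listₚ.length-map D∷_ (words a e b)) ⟩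
    length (words a e b) ℕ.* weight (suc a) e b           ≡⟨ lemma (length (words a e b)) (suc a) (a !) (e !) (b !) ⟩
    suc a ℕ.* (length (words a e b) ℕ.* weight a e b)     ≡⟨ cong (suc a ℕ.*_) (length-words a e b) ⟩
    suc a ℕ.* (a ℕ.+ e ℕ.+ b) !                           ∎
    where
    open ≡-Reasoning
    lemma : ∀ l k x y z → l ℕ.* (k ℕ.* x ℕ.* y ℕ.* z) ≡ k ℕ.* (l ℕ.* (x ℕ.* y ℕ.* z))
    lemma = ℕ-solve-∀

  length-wordsE : ∀ a e b → length (wordsE a e b) ℕ.* weight a e b ≡ e ℕ.* (a ℕ.+ e ℕ.+ b ∸ 1) !
  length-wordsE a zero    b = refl
  length-wordsE a (suc e) b = begin
    length (map E∷_ (words a e b)) ℕ.* weight a (suc e) b ≡⟨ cong (ℕ._* weight a (suc e) b) (Listₚ.length-map E∷_ (words a e b)) ⟩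
    length (words a e b) ℕ.* weight a (suc e) b           ≡⟨ lemma (length (words a e b)) (suc e) (a !) (e !) (b !) ⟩
    suc e ℕ.* (length (words a e b) ℕ.* weight a e b)     ≡⟨ cong (suc e ℕ.*_) (length-words a e b) ⟩
    suc e ℕ.* (a ℕ.+ e ℕ.+ b) !                           ≡⟨ cong (λ k → suc e ℕ.* (k ℕ.+ b ∸ 1) !) (sym (ℕₚ.+-suc a e)) ⟩
    suc e ℕ.* (a ℕ.+ suc e ℕ.+ b ∸ 1) !                   ∎
    where
    open ≡-Reasoning
    lemma : ∀ l k x y z → l ℕ.* (x ℕ.* (k ℕ.* y) ℕ.* z) ≡ k ℕ.* (l ℕ.* (x ℕ.* y ℕ.* z))
    lemma = ℕ-solve-∀

  length-wordsN : ∀ a e b → length (wordsN a e b) ℕ.* weight a e b ≡ b ℕ.* (a ℕ.+ e ℕ.+ b ∸ 1) !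
  length-wordsN a e zero    = refl
  length-wordsN a e (suc b) = begin
    length (map N∷_ (words a e b)) ℕ.* weight a e (suc b) ≡⟨ cong (ℕ._* weight a e (suc b)) (Listₚ.length-map N∷_ (words a e b)) ⟩
    length (words a e b) ℕ.* weight a e (suc b)           ≡⟨ lemma (length (words a e b)) (suc b) (a !) (e !) (b !) ⟩
    suc b ℕ.* (length (words a e b) ℕ.* weight a e b)     ≡⟨ cong (suc b ℕ.*_) (length-words a e b) ⟩
    suc b ℕ.* (a ℕ.+ e ℕ.+ b) !                           ≡⟨ cong (λ k → suc b ℕ.* (k ∸ 1) !) (sym (ℕₚ.+-suc (a ℕ.+ e) b)) ⟩
    suc b ℕ.* (a ℕ.+ e ℕ.+ suc b ∸ 1) !                   ∎
    where
    open ≡-Reasoning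
    lemma : ∀ l k x y z → l ℕ.* (x ℕ.* y ℕ.* (k ℕ.* z)) ≡ k ℕ.* (l ℕ.* (x ℕ.* y ℕ.* z))
    lemma = ℕ-solve-∀

-- Stated for a total injective relation, so that one relation between pairs and words can be used
-- in both directions.
length-≤-injective : ∀ {A B : Set} {xs : List A} {ys : List B} (S : A → B → Set) → Unique xs →
  (∀ x → x ∈ xs → ∃ λ y → y ∈ ys × S x y) → (∀ {x x′ y} → x ∈ xs → x′ ∈ xs → S x y → S x′ y → x ≡ x′) →
  length xs ℕ.≤ length ys
length-≤-injective {xs = []} S _ _ _ = z≤n
length-≤-injective {xs = x ∷ xs} S (x∉ ∷ uxs) total inj with total x (here refl)
... | y , y∈ , Sxy with ∈⇒↭∷ y∈
...   | zs , ys↭ = subst (suc (length xs) ℕ.≤_) (sym (↭-length ys↭)) (s≤s (length-≤-injective S uxs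
        (λ x′ x′∈ → let y′ , y′∈ , Sx′y′ = total x′ (there x′∈) in
          y′ , ∷-≢⇒∈ (∈-resp-↭ ys↭ y′∈) (λ { refl → All.lookup x∉ x′∈ (inj (here refl) (there x′∈) Sxy Sx′y′) }) , Sx′y′)
        (λ p q → inj (there p) (there q))))

image : ∀ {A B : Set} (Q : A → B → Set) xs → (∀ x → x ∈ xs → ∃ (Q x)) →
        ∃ λ ys → (∀ x → x ∈ xs → ∃ λ y → y ∈ ys × Q x y) × (∀ y → y ∈ ys → ∃ λ x → x ∈ xs × Q x y)
image Q []       f = [] , (λ _ ()) , (λ _ ())
image Q (x ∷ xs) f =
  let y , q = f x (here refl)
      ys , to , from = image Q xs (λ x x∈ → f x (there x∈))
  in y ∷ ys ,
     (λ { _ (here refl) → y , here refl , q ; x′ (there x∈) → let y′ , y∈ , q′ = to x′ x∈ in y′ , there y∈ , q′ }) ,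
     (λ { _ (here refl) → x , here refl , q ; y′ (there y∈) → let x′ , x∈ , q′ = from y′ y∈ in x′ , there x∈ , q′ })

length-cartesianProduct : ∀ {A B : Set} (xs : List A) (ys : List B) →
                          length (cartesianProduct xs ys) ≡ length xs ℕ.* length ys
length-cartesianProduct []       ys = refl
length-cartesianProduct (x ∷ xs) ys = trans (Listₚ.length-++ (map (x ,_) ys))
  (cong₂ ℕ._+_ (Listₚ.length-map (x ,_) ys) (length-cartesianProduct xs ys))

_≟ᵇ_ : (B B′ : Bipartition) → Dec (B ≡ B′)
_≟ᵇ_ = ×-≡-dec (Listₚ.≡-dec ℕₚ._≟_) (Listₚ.≡-dec ℕₚ._≟_)

module _ (a e b : ℕ) .{{_ : ℕ.NonZero (a ℕ.+ e)}} (coprime : Coprime (a ℕ.+ e) (a ℕ.+ b)) where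
  private
    s = a ℕ.+ e
    t = a ℕ.+ b
  open Modulo s
  open Path s t
  open Correspondence s t coprime

  SimultaneouslyNested : Bipartition → Set
  SimultaneouslyNested (l , m) =
    IsBipartition (l , m) × Nested s (Bead 0ℤ l) (Bead (+ a) m) × Nested t (Bead 0ℤ l) (Bead (+ a) m)

  Encodes : Bipartition × ℕ → Word a e b → Set
  Encodes (B , r) w = IsBipartition B × ∃ λ p → p ≋ + r × Describes (+ a) B w p

  bipartition-word : ∀ B r → SimultaneouslyNested B → ∃ λ w → w ∈ startWords a e b × Encodes (B , r) w
  bipartition-word B r (ib , ns , nt) with bipartition⇒word ib ns nt (+ r)
  ... | e′ , b′ , eq , eq′ , w , st , d
    with refl ← ℕₚ.+-cancelˡ-≡ a e′ e eq | refl ← ℕₚ.+-cancelˡ-≡ a b′ b eq′ = w , ∈-startWords w st , ib , d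

  word-bipartition : ∀ w → ∃ λ B → SimultaneouslyNested B × ∃ λ r → r ℕ.< s × Encodes (B , r) w
  word-bipartition w =
    let B , ib , p , d = word⇒bipartition w refl
        ns , nt = describes-nested {B = B} p w refl refl d
        r , r<s , r≋p = CoprimePath.residue s t coprime p
    in B , (ib , ns , nt) , r , r<s , ib , p , ≋-sym r≋p , d

  encodes-unique : ∀ {B B′ r r′} w → r ℕ.< s → r′ ℕ.< s → Encodes (B , r) w → Encodes (B′ , r′) w → (B , r) ≡ (B′ , r′)
  encodes-unique {B} {B′} {r} w r<s r′<s (ib , p , c , d) (ib′ , p′ , c′ , d′) =
    let p≡p′ , B≡B′ = describes-unique {B = B} {B′} w ib ib′ d d′
    in cong₂ _,_ B≡B′ (residue-unique s r<s r′<s (≋-trans (≋-sym c′) (subst (_≋ + r) p≡p′ c)))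

  encodes-same-word : ∀ {Br w w′} → Start w → Start w′ → Encodes Br w → Encodes Br w′ → w ≡ w′
  encodes-same-word {B , r} st st′ (_ , p , c , d) (_ , p′ , c′ , d′) =
    describes-same-word {B = B} _ _ refl refl st st′ (≋-trans c (≋-sym c′)) d d′

  nested-bipartitions : ∃ λ L → Unique L × (∀ B → B ∈ L ⇔ SimultaneouslyNested B) ×
                                length L ℕ.* weight a e b ≡ (s ℕ.+ b ∸ 1) !
  nested-bipartitions = L , deduplicate-! _≟ᵇ_ Bs , (λ B → mk⇔ (sound B) (complete B)) , count
    where
    Q : Word a e b → Bipartition → Set
    Q w B = SimultaneouslyNested B × ∃ λ r → r ℕ.< s × Encodes (B , r) w
    img = image Q (startWords a e b) (λ w _ → word-bipartition w)
    Bs L : List Bipartition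
    Bs = proj₁ img
    -- A bipartition arises from s words, one for each starting class, so the repetitions must be
    -- removed.
    L = deduplicate _≟ᵇ_ Bs
    to = proj₁ (proj₂ img)
    sound : ∀ B → B ∈ L → SimultaneouslyNested B
    sound B B∈ = let w , _ , sn , _ = proj₂ (proj₂ img) B (∈-deduplicate⁻ _≟ᵇ_ Bs B∈) in sn
    member : ∀ w → w ∈ startWords a e b → ∃ λ Br → Br ∈ cartesianProduct L (upTo s) × Encodes Br w
    member w w∈ = let B , B∈ , sn , r , r<s , enc = to w w∈ in
      (B , r) , ∈-cartesianProduct⁺ (∈-deduplicate⁺ _≟ᵇ_ B∈) (∈-upTo⁺ r<s) , enc
    complete : ∀ B → SimultaneouslyNested B → B ∈ L
    complete B sn =
      -- The class 0 is an arbitrary choice. As a word encodes only one pair, the bipartition listed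
      -- for this word is B.
      let w , w∈ , enc = bipartition-word B 0 sn
          B′ , B′∈ , _ , r , r<s , enc′ = to w w∈
      in subst (_∈ L) (cong proj₁ (encodes-unique w r<s (ℕ.>-nonZero⁻¹ s) enc′ enc)) (∈-deduplicate⁺ _≟ᵇ_ B′∈)
    length≡ : length L ℕ.* s ≡ length (startWords a e b)
    length≡ = trans (trans (cong (length L ℕ.*_) (sym (Listₚ.length-upTo s))) (sym (length-cartesianProduct L (upTo s))))
      (ℕₚ.≤-antisym
        (length-≤-injective Encodes (Uniqueₚ.cartesianProduct⁺ (deduplicate-! _≟ᵇ_ Bs) (Uniqueₚ.upTo⁺ s))
          (λ { (B , r) Br∈ → bipartition-word B r (sound B (proj₁ (∈-cartesianProduct⁻ L (upTo s) Br∈))) })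
          (λ {_} {_} {w} p q → encodes-unique w (∈-upTo⁻ (proj₂ (∈-cartesianProduct⁻ L (upTo s) p))) (∈-upTo⁻ (proj₂ (∈-cartesianProduct⁻ L (upTo s) q)))))
        (length-≤-injective (λ w Br → Encodes Br w) (startWords-unique a e b) member
          (λ w∈ w′∈ → encodes-same-word (startWords-start a e b w∈) (startWords-start a e b w′∈))))
    count : length L ℕ.* weight a e b ≡ (s ℕ.+ b ∸ 1) !
    count = ℕₚ.*-cancelˡ-≡ _ _ s (begin
      s ℕ.* (length L ℕ.* weight a e b)             ≡⟨ lemma s (length L) (weight a e b) ⟩
      length L ℕ.* s ℕ.* weight a e b               ≡⟨ cong (ℕ._* weight a e b) length≡ ⟩
      length (startWords a e b) ℕ.* weight a e b    ≡⟨ length-startWords a e b ⟩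
      s ℕ.* (s ℕ.+ b ∸ 1) !                         ∎)
      where
      open ≡-Reasoning
      lemma : ∀ s l w → s ℕ.* (l ℕ.* w) ≡ l ℕ.* s ℕ.* w
      lemma = ℕ-solve-∀

theorem4p7 : (a s t : ℕ) → a ℕ.< s → s ℕ.≤ t → Coprime s t →
    Σ (List Bipartition) λ L →
      Unique L
      × (∀ (B : Bipartition) →
           B ∈ L ⇔ (IsBipartition B × IsCore s (0ℤ , + a) B × IsCore t (0ℤ , + a) B))
      × length L ℕ.* ((a !) ℕ.* ((s ∸ a) !) ℕ.* ((t ∸ a) !)) ≡ (s ℕ.+ t ∸ a ∸ 1) !
theorem4p7 a s t a<s s≤t coprime = cores (s ∸ a) (t ∸ a) (ℕₚ.m+[n∸m]≡n (ℕₚ.<⇒≤ a<s)) (ℕₚ.m+[n∸m]≡n a≤t)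
  where
  a<t = ℕₚ.<-≤-trans a<s s≤t
  a≤t = ℕₚ.<⇒≤ a<t
  cores : ∀ e b → a ℕ.+ e ≡ s → a ℕ.+ b ≡ t →
    ∃ λ L → Unique L × (∀ B → B ∈ L ⇔ (IsBipartition B × IsCore s (0ℤ , + a) B × IsCore t (0ℤ , + a) B))
      × length L ℕ.* weight a e b ≡ (s ℕ.+ t ∸ a ∸ 1) !
  cores e b refl refl =
    let L , unique , mem , count = nested-bipartitions a e b {{ℕ.>-nonZero (ℕₚ.≤-<-trans z≤n a<s)}} coprime
    in L , unique ,
      (λ B → mk⇔
        (λ B∈ → let ib , ns , nt = Equivalence.to (mem B) B∈ in
           ib , nested⇒core s a a<s ib ns , nested⇒core t a a<t ib nt)
        (λ (ib , cs , ct) → Equivalence.from (mem B)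
           (ib , core⇒nested s a a<s ib cs , core⇒nested t a a<t ib ct))) ,
      trans count (cong (λ n → (n ∸ 1) !) (sum≡ e b))
    where
    sum≡ : ∀ e b → a ℕ.+ e ℕ.+ b ≡ a ℕ.+ e ℕ.+ (a ℕ.+ b) ∸ a
    sum≡ e b = sym (trans (cong (_∸ a) (lemma a e b)) (ℕₚ.m+n∸n≡m (a ℕ.+ e ℕ.+ b) a))
      where
      lemma : ∀ a e b → a ℕ.+ e ℕ.+ (a ℕ.+ b) ≡ a ℕ.+ e ℕ.+ b ℕ.+ a
      lemma = ℕ-solve-∀
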